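{- Let $m$ be a positive integer, $F=\mathbb{F}_{2^m}$, let $b\in F$ and put $a=b^2+b+1$. If $a\notin\{0,1\}$, then \[ K(a^4+a^3)\equiv\begin{cases}3\pmod{12}, & \text{if } m \text{ is odd},\\ 7\pmod{12}, & \text{if } m \text{ is even}.\end{cases} \]
   Context: $\mathrm{Tr}$ denotes the absolute trace from $F=\mathbb{F}_{2^m}$ to $\mathbb{F}_2$. For $a\in F\setminus\{0\}$, the Kloosterman sum is $K(a)=\sum_{x\in F\setminus\{0\}}(-1)^{\mathrm{Tr}(ax+1/x)}$. -}

module Defs where

open import Level using (0ℓ)
open import Data.Nat as ℕ using (ℕ; zero; suc; _^_)
open import Data.Fin using (Fin)
open import Data.List using (List; map; allFin; foldr)
open import Data.Integer as ℤ using (ℤ; +_)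
open import Relation.Binary.PropositionalEquality using (_≡_; _≢_)
open import Relation.Nullary using (Dec; yes; no)
open import Algebra.Structures using (IsCommutativeRing)
open import Function.Bundles using (_⤖_; Bijection)

record FiniteField (m : ℕ) : Set₁ where
  infixl 6 _+_
  infixl 7 _*_
  field
    Carrier : Set
    _+_ _*_ : Carrier → Carrier → Carrier
    -_      : Carrier → Carrier
    0# 1#   : Carrier
    isCommutativeRing : IsCommutativeRing _≡_ _+_ _*_ -_ 0# 1#
    _≟_     : (x y : Carrier) → Dec (x ≡ y)
    0≢1     : 0# ≢ 1#
    _⁻¹     : Carrier → Carrier
    inverse : (x : Carrier) → x ≢ 0# → x * (x ⁻¹) ≡ 1#
    enum    : Fin (2 ^ m) ⤖ Carrier

  pow : Carrier → ℕ → Carrier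
  pow x zero    = 1#
  pow x (suc n) = x * pow x n

  Tr : Carrier → Carrier
  Tr x = go m
    where
    go : ℕ → Carrier
    go zero    = 0#
    go (suc i) = pow x (2 ^ i) + go i

  -- (-1)^{Tr(x)} as an integer (Tr(x) ∈ {0,1} ⊆ F)
  sgn : Carrier → ℤ
  sgn x with Tr x ≟ 0#
  ... | yes _ = + 1
  ... | no  _ = ℤ.-[1+ 0 ]

  elements : List Carrier
  elements = map (Bijection.to enum) (allFin (2 ^ m))

  K : Carrier → ℤ
  K a = foldr ℤ._+_ (+ 0) (map term elements)
    where
    term : Carrier → ℤ
    term x with x ≟ 0#
    ... | yes _ = + 0
    ... | no  _ = sgn (a * x + x ⁻¹)

{-# OPTIONS --safe #-}

-- Put c = a⁴ + a³. Modulo 3: let N be the number of (p, q) with p q (p + q + 1) = a². The map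
-- (p, q) ↦ (q, p + q + 1) has order 3 on these pairs, and its only possible fixed point (1, 1) is
-- excluded by a ≠ 1, so 3 ∣ N. For fixed p the equation is quadratic in q, and by Artin–Schreier
-- theory it has 1 + (-1)^Tr(a²/(p (p+1)²)) solutions when p ≠ 0, 1; substituting
-- p = 1/(1 + (a² + a) x) and using Tr(z²) = Tr(z) gives N = 2^m - 2 + (-1)^Tr(a) K(c), where
-- Tr(a) = Tr(b² + b + 1) = Tr(1) = m. Modulo 4: the involution x ↦ 1/(c x) has no fixed point
-- among the x with Tr(c x + 1/x) = 1, so K(c) ≡ 2^m - 1, and m ≥ 2 because 𝔽₂ only has a = 1.
module Submission where

open import Defs
open import Level using (0ℓ)
open import Algebra.Bundles using (CommutativeMonoid; CommutativeRing)
open import Algebra.Solver.Ring.AlmostCommutativeRing using (fromCommutativeSemiring; _-Raw-AlmostCommutative⟶_)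
open import Data.Bool using (Bool; true; false)
open import Data.Bool.Properties using (xor-∧-commutativeRing)
open import Data.Maybe using (Maybe; just; nothing)
open import Data.Nat as ℕ using (ℕ; zero; suc; _≤_; _%_; _/_; _^_; z≤n; s≤s)
import Data.Nat.Properties as ℕ
open import Data.Nat.DivMod using (m≡m%n+[m/n]*n)
open import Data.Fin as Fin using (Fin; toℕ)
import Data.Fin.Properties as Fin
open import Data.Fin.Permutation using (permutation)
open import Data.Integer as ℤ using (ℤ; +_; _-_; -[1+_])
import Data.Integer.Properties as ℤ
open import Data.Integer.Divisibility using (_∣_)
import Data.Integer.Divisibility.Signed as S
import Data.Integer.Tactic.RingSolver as ℤ-Solver
open import Data.List using (map; foldr; tabulate)
open import Data.Product using (_×_; _,_; proj₁; proj₂; Σ; ∃)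
open import Function using (_∘_; id; case_of_)
open import Function.Bundles using (_↔_; Inverse)
open import Function.Properties.Bijection using (⤖⇒↔)
open import Relation.Binary.PropositionalEquality using (_≡_; _≢_; refl; sym; trans; cong; cong₂; subst; module ≡-Reasoning)
open import Relation.Nullary using (Dec; yes; no; ¬_; contradiction)

-- Sums over finite sets

-- With r = p + q + 1 the equation reads p q r = a² on the plane p + q + r = 1. For a other than 0
-- and 1 this is a smooth cubic on which the cyclic shift of the coordinates is translation by a
-- point of order 3; counting orbits of the shift exploits this 3-torsion without a group law. The
-- shape of a settles the sign in front of K(c), which for even m decides between the residues 1 and
-- 2 modulo 3. A field is given only by its axioms and an enumeration of 2^m elements.
-- Characteristic 2, the identity x^(2^m) = x, the values of the trace in 𝔽₂ and its surjectivity
-- all have to be derived from these. Cardinalities are expressed as integer sums of indicators over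
-- the whole field, so that every bijection becomes a reindexing of such a sum.

indicator : {P : Set} → Dec P → ℤ
indicator (yes _) = + 1
indicator (no  _) = + 0

indicator-yes : {P : Set} (P? : Dec P) → P → indicator P? ≡ + 1
indicator-yes (yes _) _ = refl
indicator-yes (no ¬p) p = contradiction p ¬p

indicator-no : {P : Set} (P? : Dec P) → ¬ P → indicator P? ≡ + 0
indicator-no (yes p) ¬p = contradiction p ¬p
indicator-no (no _)  _  = refl

indicator-cong : {P Q : Set} (P? : Dec P) (Q? : Dec Q) → (P → Q) → (Q → P) → indicator P? ≡ indicator Q?
indicator-cong (yes p) Q? f g = sym (indicator-yes Q? (f p))
indicator-cong (no ¬p) Q? f g = sym (indicator-no Q? (¬p ∘ g))

-- The monoid is arbitrary because it serves twice: additively on the integers for counting,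
-- multiplicatively on the field for Fermat's identity.
module FiniteSum {A : Set} {N : ℕ} (E : Fin N ↔ A) (M : CommutativeMonoid 0ℓ 0ℓ) where
  open CommutativeMonoid M using (_≈_; _∙_; ε; ∙-congˡ; identityʳ)
    renaming (Carrier to B; trans to ≈-trans; reflexive to ≈-reflexive)
  open Inverse E using (to; from; strictlyInverseˡ; strictlyInverseʳ)
  open import Algebra.Properties.CommutativeMonoid.Sum M
    using (sum; sum-cong-≋; sum-permute; sum-remove; sum-replicate-zero; ∑-distrib-+; ∑-comm)

  ∑ : (A → B) → B
  ∑ f = sum (f ∘ to)

  ∑-cong : {f g : A → B} → (∀ x → f x ≈ g x) → ∑ f ≈ ∑ g
  ∑-cong f≈g = sum-cong-≋ (f≈g ∘ to)

  ∑-distrib : (f g : A → B) → ∑ (λ x → f x ∙ g x) ≈ ∑ f ∙ ∑ g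
  ∑-distrib f g = ∑-distrib-+ (f ∘ to) (g ∘ to)

  ∑-swap : (f : A → A → B) → ∑ (λ x → ∑ (f x)) ≈ ∑ (λ y → ∑ (λ x → f x y))
  ∑-swap f = ∑-comm (λ i j → f (to i) (to j))

  ∑-ε : ∑ (λ _ → ε) ≈ ε
  ∑-ε = sum-replicate-zero N

  ∑-reindex : (f : A → B) (φ ψ : A → A) → (∀ x → φ (ψ x) ≡ x) → (∀ x → ψ (φ x) ≡ x) → ∑ f ≈ ∑ (f ∘ φ)
  ∑-reindex f φ ψ φψ ψφ = ≈-trans
    (sum-permute (f ∘ to) (permutation (conj φ) (conj ψ) (conj-inverse φ ψ φψ) (conj-inverse ψ φ ψφ)))
    (sum-cong-≋ {N} {λ i → f (to (conj φ i))} {f ∘ φ ∘ to} λ i → ≈-reflexive (cong f (strictlyInverseˡ _)))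
    where
    conj : (A → A) → Fin N → Fin N
    conj φ i = from (φ (to i))

    conj-inverse : (φ ψ : A → A) → (∀ x → φ (ψ x) ≡ x) → ∀ i → conj φ (conj ψ i) ≡ i
    conj-inverse φ ψ φψ i = trans
      (cong (from ∘ φ) (strictlyInverseˡ _)) (trans (cong from (φψ _)) (strictlyInverseʳ i))

  ∑-single : (f : A → B) (a : A) → (∀ x → x ≢ a → f x ≈ ε) → ∑ f ≈ f a
  ∑-single f a f≈ε = ≈-trans (sum-single (f ∘ to) (from a) λ j j≢ → f≈ε _ (j≢ ∘ to-injective j))
    (≈-reflexive (cong f (strictlyInverseˡ a)))
    where
    to-injective : ∀ j → to j ≡ a → j ≡ from a
    to-injective j eq = trans (sym (strictlyInverseʳ j)) (cong from eq)

    sum-single : ∀ {n} (t : Fin n → B) i → (∀ j → j ≢ i → t j ≈ ε) → sum t ≈ t i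
    sum-single {suc n} t i t≈ε = ≈-trans (sum-remove {i = i} t) (≈-trans
      (∙-congˡ (≈-trans (sum-cong-≋ λ j → t≈ε _ (Fin.punchInᵢ≢i i j)) (sum-replicate-zero n)))
      (identityʳ _))

module IntegerSum {A : Set} {N : ℕ} (E : Fin N ↔ A) where
  open Inverse E using (to; from; strictlyInverseˡ)
  open FiniteSum E ℤ.+-0-commutativeMonoid public
  open import Algebra.Properties.Semiring.Sum ℤ.+-*-semiring using (sum; *-distribˡ-sum)

  ∑-*ˡ : (k : ℤ) (f : A → ℤ) → ∑ (λ x → k ℤ.* f x) ≡ k ℤ.* ∑ f
  ∑-*ˡ k f = sym (*-distribˡ-sum k (f ∘ to))

  ∑-1 : ∑ (λ _ → + 1) ≡ + N
  ∑-1 = sum-1 N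
    where
    sum-1 : ∀ n → sum {n} (λ _ → + 1) ≡ + n
    sum-1 zero    = refl
    sum-1 (suc n) = cong (ℤ._+_ (+ 1)) (sum-1 n)

  ∑-foldr : (f : A → ℤ) → foldr ℤ._+_ (+ 0) (map f (map to (tabulate id))) ≡ ∑ f
  ∑-foldr f = go id
    where
    -- Generalised from `id` because the tail of `tabulate g` is tabulated by `g ∘ Fin.suc`.
    go : ∀ {n} (g : Fin n → Fin N) → foldr ℤ._+_ (+ 0) (map f (map to (tabulate g))) ≡ sum (f ∘ to ∘ g)
    go {zero}  g = refl
    go {suc n} g = cong (ℤ._+_ (f (to (g Fin.zero)))) (go (g ∘ Fin.suc))

  private
    -- The enumeration lends `A` a linear order, from which one representative of each orbit is
    -- chosen.
    rank : A → ℕ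
    rank = toℕ ∘ from

    rank-injective : ∀ {x y} → rank x ≡ rank y → x ≡ y
    rank-injective {x} {y} eq =
      trans (sym (strictlyInverseˡ x)) (trans (cong to (Fin.toℕ-injective eq)) (strictlyInverseˡ y))

    less : A → A → ℤ
    less x y = indicator (rank x ℕ.<? rank y)

  -- Each 2-cycle is counted by its element of smaller rank.
  involution⇒2∣∑ : (f : A → ℤ) (σ : A → A) → (∀ x → σ (σ x) ≡ x) → (∀ x → f (σ x) ≡ f x) →
                   (∀ x → σ x ≡ x → f x ≡ + 0) → + 2 S.∣ ∑ f
  involution⇒2∣∑ f σ σσ fσ fix = S.divides (∑ g) (begin
    ∑ f                      ≡⟨ ∑-cong split ⟩
    ∑ (λ x → g x ℤ.+ g (σ x))  ≡⟨ ∑-distrib g (g ∘ σ) ⟩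
    ∑ g ℤ.+ ∑ (g ∘ σ)          ≡⟨ cong (ℤ._+_ (∑ g)) (∑-reindex g σ σ σσ σσ) ⟨
    ∑ g ℤ.+ ∑ g                ≡⟨ double (∑ g) ⟩
    ∑ g ℤ.* + 2                ∎)
    where
    open ≡-Reasoning
    g : A → ℤ
    g x = f x ℤ.* less x (σ x)

    double : ∀ k → k ℤ.+ k ≡ k ℤ.* + 2
    double = ℤ-Solver.solve-∀

    yes-no : ∀ k → k ≡ k ℤ.* + 1 ℤ.+ k ℤ.* + 0
    yes-no = ℤ-Solver.solve-∀

    no-yes : ∀ k → k ≡ k ℤ.* + 0 ℤ.+ k ℤ.* + 1
    no-yes = ℤ-Solver.solve-∀

    split′ : ∀ x → f x ≡ f x ℤ.* less x (σ x) ℤ.+ f x ℤ.* less (σ x) x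
    split′ x with rank x ℕ.<? rank (σ x) | rank (σ x) ℕ.<? rank x
    ... | yes p | yes q = contradiction q (ℕ.<-asym p)
    ... | yes p | no  q = yes-no (f x)
    ... | no  p | yes q = no-yes (f x)
    -- Equal ranks mean a fixed point of `σ`, where `f` vanishes.
    ... | no  p | no  q
      rewrite fix x (rank-injective (ℕ.≤-antisym (ℕ.≮⇒≥ p) (ℕ.≮⇒≥ q))) = refl

    split : ∀ x → f x ≡ g x ℤ.+ g (σ x)
    split x = trans (split′ x) (cong (ℤ._+_ (g x)) (sym (cong₂ (λ u v → u ℤ.* less (σ x) v) (fσ x) (σσ x))))

  -- Each 3-cycle (p, q) → (q, r) → (r, p), where r = r p q, is counted by its element
  -- whose first entry is the first occurrence of the smallest of p, q, r.
  rotation⇒3∣∑∑ : (f : A → A → ℤ) (r : A → A → A) → (∀ p q → r q (r p q) ≡ p) →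
                  (∀ p q → f q (r p q) ≡ f p q) → (∀ p → r p p ≡ p → f p p ≡ + 0) →
                  + 3 S.∣ ∑ (λ p → ∑ (f p))
  rotation⇒3∣∑∑ f r rot fr fix = S.divides (∑∑ g) (begin
    ∑∑ f                                             ≡⟨ ∑∑-cong split ⟩
    ∑∑ (λ p q → g p q ℤ.+ (turn g p q ℤ.+ turn (turn g) p q))
      ≡⟨ ∑∑-distrib g (λ p q → turn g p q ℤ.+ turn (turn g) p q) ⟩
    ∑∑ g ℤ.+ ∑∑ (λ p q → turn g p q ℤ.+ turn (turn g) p q)
      ≡⟨ cong (ℤ._+_ (∑∑ g)) (∑∑-distrib (turn g) (turn (turn g))) ⟩
    ∑∑ g ℤ.+ (∑∑ (turn g) ℤ.+ ∑∑ (turn (turn g)))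
      ≡⟨ cong₂ (λ u v → ∑∑ g ℤ.+ (u ℤ.+ v)) (∑∑-turn g) (trans (∑∑-turn (turn g)) (∑∑-turn g)) ⟩
    ∑∑ g ℤ.+ (∑∑ g ℤ.+ ∑∑ g)                             ≡⟨ triple (∑∑ g) ⟩
    ∑∑ g ℤ.* + 3                                       ∎)
    where
    open ≡-Reasoning
    ∑∑ : (A → A → ℤ) → ℤ
    ∑∑ h = ∑ (λ p → ∑ (h p))

    turn : (A → A → ℤ) → A → A → ℤ
    turn h p q = h q (r p q)

    ∑∑-cong : {h k : A → A → ℤ} → (∀ p q → h p q ≡ k p q) → ∑∑ h ≡ ∑∑ k
    ∑∑-cong eq = ∑-cong λ p → ∑-cong (eq p)

    ∑∑-distrib : ∀ h k → ∑∑ (λ p q → h p q ℤ.+ k p q) ≡ ∑∑ h ℤ.+ ∑∑ k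
    ∑∑-distrib h k = trans (∑-cong λ p → ∑-distrib (h p) (k p)) (∑-distrib (λ p → ∑ (h p)) (λ p → ∑ (k p)))

    rot₂ : ∀ p q → r (r p q) p ≡ q
    rot₂ p q = trans (cong (r (r p q)) (sym (rot p q))) (rot q (r p q))

    -- For fixed `q` the map `p ↦ r p q` is a permutation with inverse `r q`, so once the sums are
    -- exchanged the inner one is merely reindexed.
    ∑∑-turn : ∀ h → ∑∑ (turn h) ≡ ∑∑ h
    ∑∑-turn h = trans (∑-swap (turn h))
      (∑-cong λ q → sym (∑-reindex (h q) (λ p → r p q) (r q) (rot₂ q) (λ p → rot p q)))

    -- In cyclic order `s` precedes `p` and `q` follows it. The test is strict against `s` and weak
    -- against `q`, so that two equal minima are counted once.
    first : A → A → A → ℤ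
    first p q s = less p s ℤ.* (+ 1 - less q p)

    g : A → A → ℤ
    g p q = f p q ℤ.* first p q (r p q)

    triple : ∀ k → k ℤ.+ (k ℤ.+ k) ≡ k ℤ.* + 3
    triple = ℤ-Solver.solve-∀

    -- With α, β, γ the truth values of p < s, q < p, s < q, the sum is α(1 - β) + β(1 - γ) + γ(1 -
    -- α), which is 1 unless all three agree. All true would be a cycle of strict inequalities; all
    -- false forces p = q = s.
    firsts-sum : ∀ p q s → ¬ (p ≡ q × s ≡ p) → first p q s ℤ.+ (first q s p ℤ.+ first s p q) ≡ + 1
    firsts-sum p q s ¬all with rank p ℕ.<? rank s | rank q ℕ.<? rank p | rank s ℕ.<? rank q
    ... | yes p<s | yes q<p | yes s<q = contradiction (ℕ.<-trans p<s (ℕ.<-trans s<q q<p)) (ℕ.<-irrefl refl)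
    ... | yes _   | yes _   | no  _   = refl
    ... | yes _   | no  _   | yes _   = refl
    ... | yes _   | no  _   | no  _   = refl
    ... | no  _   | yes _   | yes _   = refl
    ... | no  _   | yes _   | no  _   = refl
    ... | no  _   | no  _   | yes _   = refl
    ... | no  p≮s | no  q≮p | no  s≮q = contradiction
      ( rank-injective (ℕ.≤-antisym p≤q (ℕ.≤-trans q≤s s≤p))
      , rank-injective (ℕ.≤-antisym s≤p (ℕ.≤-trans p≤q q≤s)) ) ¬all
      where
      s≤p = ℕ.≮⇒≥ p≮s
      p≤q = ℕ.≮⇒≥ q≮p
      q≤s = ℕ.≮⇒≥ s≮q

    g-turn : ∀ p q → turn g p q ≡ f p q ℤ.* first q (r p q) p
    g-turn p q = cong₂ (λ u v → u ℤ.* first q (r p q) v) (fr p q) (rot p q)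

    g-turn² : ∀ p q → turn (turn g) p q ≡ f p q ℤ.* first (r p q) p q
    g-turn² p q = trans (g-turn q (r p q))
      (cong₂ (λ u v → u ℤ.* first (r p q) v q) (fr p q) (rot p q))

    f-vanishes : ∀ p q → p ≡ q → r p q ≡ p → f p q ≡ + 0
    f-vanishes p .p refl = fix p

    split : ∀ p q → f p q ≡ g p q ℤ.+ (turn g p q ℤ.+ turn (turn g) p q)
    split p q = trans (f-firsts (f p q) _ _ _ total) (cong (ℤ._+_ (g p q)) (sym (cong₂ ℤ._+_ (g-turn p q) (g-turn² p q))))
      where
      s = r p q
      total : f p q ≡ f p q ℤ.* (first p q s ℤ.+ (first q s p ℤ.+ first s p q))
      -- A pair on which `f` is nonzero is not fixed by the rotation, as `firsts-sum` requires.
      total with f p q ℤ.≟ + 0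
      ... | yes f≡0 = trans f≡0 (sym (cong (ℤ._* _) f≡0))
      ... | no  f≢0 = trans (sym (ℤ.*-identityʳ _)) (cong (f p q ℤ.*_)
                        (sym (firsts-sum p q s λ (p≡q , s≡p) → f≢0 (f-vanishes p q p≡q s≡p))))

      f-firsts : ∀ k x y z → k ≡ k ℤ.* (x ℤ.+ (y ℤ.+ z)) → k ≡ k ℤ.* x ℤ.+ (k ℤ.* y ℤ.+ k ℤ.* z)
      f-firsts k x y z eq = trans eq (expand k x y z)
        where
        expand : ∀ k x y z → k ℤ.* (x ℤ.+ (y ℤ.+ z)) ≡ k ℤ.* x ℤ.+ (k ℤ.* y ℤ.+ k ℤ.* z)
        expand = ℤ-Solver.solve-∀

2∣2^ : ∀ {m} → 1 ≤ m → + 2 S.∣ + (2 ^ m)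
2∣2^ {suc k} _ = S.divides (+ (2 ^ k)) (trans (cong +_ (ℕ.*-comm 2 (2 ^ k))) (ℤ.pos-* (2 ^ k) 2))

-- The auxiliary function of FiniteField.Tr cannot be named from outside Defs, so it is recovered
-- by unification. Abstracting suc n separates the degree of the field from the number of
-- summands, after which the equation in Tr-suc determines partialTrace.
mutual
  partialTrace : ∀ {m} (F : FiniteField m) → FiniteField.Carrier F → ℕ → FiniteField.Carrier F
  partialTrace F x n = _

  Tr-suc : ∀ n (F : FiniteField (suc n)) x → let open FiniteField F in
           Tr x ≡ pow x (2 ^ n) + partialTrace F x n
  Tr-suc n F x with suc n
  ... | _ = refl

-- Arithmetic in a field of 2^m elements

module FieldProperties {m : ℕ} (F : FiniteField m) (1≤m : 1 ≤ m) where
  open FiniteField F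

  commutativeRing : CommutativeRing 0ℓ 0ℓ
  commutativeRing = record { isCommutativeRing = isCommutativeRing }

  open CommutativeRing commutativeRing
    using (+-identityˡ; +-identityʳ; *-identityˡ; *-identityʳ; *-comm; *-assoc; zeroˡ; zeroʳ; distribˡ; -‿inverseʳ; *-commutativeMonoid; ring)
  open import Algebra.Properties.Ring ring using (-0#≈0#; -‿involutive)
  open ≡-Reasoning

  E : Fin (2 ^ m) ↔ Carrier
  E = ⤖⇒↔ enum

  open Inverse E using (to; from; strictlyInverseʳ)
  open IntegerSum E

  *-cancelˡ-0 : ∀ {x y} → x ≢ 0# → x * y ≡ 0# → y ≡ 0#
  *-cancelˡ-0 {x} {y} x≢0 xy≡0 = begin
    y                ≡⟨ *-identityˡ y ⟨
    1# * y           ≡⟨ cong (_* y) (inverse x x≢0) ⟨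
    x * x ⁻¹ * y     ≡⟨ cong (_* y) (*-comm x (x ⁻¹)) ⟩
    x ⁻¹ * x * y     ≡⟨ *-assoc _ _ _ ⟩
    x ⁻¹ * (x * y)   ≡⟨ cong (x ⁻¹ *_) xy≡0 ⟩
    x ⁻¹ * 0#        ≡⟨ zeroʳ _ ⟩
    0#               ∎

  *-≢0 : ∀ {x y} → x ≢ 0# → y ≢ 0# → x * y ≢ 0#
  *-≢0 x≢0 y≢0 = y≢0 ∘ *-cancelˡ-0 x≢0

  *≡1⇒≢0 : ∀ {x y} → x * y ≡ 1# → x ≢ 0#
  *≡1⇒≢0 xy≡1 refl = 0≢1 (trans (sym (zeroˡ _)) xy≡1)

  ∑-indicator : ∀ a → ∑ (λ x → indicator (x ≟ a)) ≡ + 1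
  ∑-indicator a = trans
    (∑-single (λ x → indicator (x ≟ a)) a (λ x → indicator-no (x ≟ a))) (indicator-yes (a ≟ a) refl)

  nonzero : Carrier → ℤ
  nonzero x = + 1 - indicator (x ≟ 0#)

  ∑-nonzero : ∑ nonzero ≡ + (2 ^ m) - + 1
  ∑-nonzero = begin
    ∑ nonzero                                                  ≡⟨ ∑-cong (λ x → cong (ℤ._+_ (+ 1)) (sym (ℤ.-1*i≡-i (indicator (x ≟ 0#))))) ⟩
    ∑ (λ x → + 1 ℤ.+ ℤ.-1ℤ ℤ.* indicator (x ≟ 0#))           ≡⟨ ∑-distrib (λ _ → + 1) (λ x → ℤ.-1ℤ ℤ.* indicator (x ≟ 0#)) ⟩
    ∑ (λ _ → + 1) ℤ.+ ∑ (λ x → ℤ.-1ℤ ℤ.* indicator (x ≟ 0#))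
      ≡⟨ cong₂ ℤ._+_ ∑-1 (trans (∑-*ˡ ℤ.-1ℤ (λ x → indicator (x ≟ 0#))) (cong (ℤ._*_ ℤ.-1ℤ) (∑-indicator 0#))) ⟩
    + (2 ^ m) - + 1                                            ∎

  -- Otherwise negation would be an involution with a single fixed point on a set of even size.
  1+1≡0 : 1# + 1# ≡ 0#
  1+1≡0 with (1# + 1#) ≟ 0#
  ... | yes eq = eq
  ... | no 2≢0 = contradiction 2∣1 λ where (S.divides (+ zero) ()) ; (S.divides (+ suc _) ()) ; (S.divides -[1+ _ ] ())
    where
    neg-fixed : ∀ x → - x ≡ x → x ≡ 0#
    neg-fixed x -x≡x = *-cancelˡ-0 2≢0 (begin
      (1# + 1#) * x      ≡⟨ *-comm _ _ ⟩
      x * (1# + 1#)      ≡⟨ distribˡ x 1# 1# ⟩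
      x * 1# + x * 1#    ≡⟨ cong₂ _+_ (*-identityʳ x) (*-identityʳ x) ⟩
      x + x              ≡⟨ cong (_+_ x) -x≡x ⟨
      x + - x            ≡⟨ -‿inverseʳ x ⟩
      0#                 ∎)

    neg-nonzero : ∀ x → nonzero (- x) ≡ nonzero x
    neg-nonzero x = cong (_-_ (+ 1)) (indicator-cong ((- x) ≟ 0#) (x ≟ 0#)
      (λ eq → trans (sym (-‿involutive x)) (trans (cong -_ eq) -0#≈0#))
      (λ eq → trans (cong -_ eq) -0#≈0#))

    2∣1 : + 2 S.∣ + 1
    2∣1 = subst (+ 2 S.∣_) (i-[i-1] (+ (2 ^ m))) (S.∣m∣n⇒∣m-n (2∣2^ 1≤m) (subst (+ 2 S.∣_) ∑-nonzero
      (involution⇒2∣∑ nonzero -_ -‿involutive neg-nonzero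
        λ x eq → cong (_-_ (+ 1)) (indicator-yes (x ≟ 0#) (neg-fixed x eq)))))
      where
      i-[i-1] : ∀ i → i - (i - + 1) ≡ + 1
      i-[i-1] = ℤ-Solver.solve-∀

  +-self : ∀ x → x + x ≡ 0#
  +-self x = begin
    x + x              ≡⟨ cong₂ _+_ (*-identityʳ x) (*-identityʳ x) ⟨
    x * 1# + x * 1#    ≡⟨ distribˡ x 1# 1# ⟨
    x * (1# + 1#)      ≡⟨ cong (x *_) 1+1≡0 ⟩
    x * 0#             ≡⟨ zeroʳ x ⟩
    0#                 ∎

  private
    ring₂ = fromCommutativeSemiring (CommutativeRing.commutativeSemiring commutativeRing)
    rawRing₂ = CommutativeRing.rawRing xor-∧-commutativeRing

    ⟦_⟧₂ : Bool → Carrier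
    ⟦ true ⟧₂  = 1#
    ⟦ false ⟧₂ = 0#

    morphism₂ : rawRing₂ -Raw-AlmostCommutative⟶ ring₂
    morphism₂ = record
      { ⟦_⟧    = ⟦_⟧₂
      ; +-homo = λ where
          true  true  → sym 1+1≡0
          true  false → sym (+-identityʳ 1#)
          false y     → sym (+-identityˡ ⟦ y ⟧₂)
      ; *-homo = λ where
          true  y → sym (*-identityˡ ⟦ y ⟧₂)
          false y → sym (zeroˡ ⟦ y ⟧₂)
      ; -‿homo = λ _ → refl
      ; 0-homo = refl
      ; 1-homo = refl
      }

    _≟₂_ : ∀ x y → Maybe (⟦ x ⟧₂ ≡ ⟦ y ⟧₂)
    true  ≟₂ true  = just refl
    false ≟₂ false = just refl
    _     ≟₂ _     = nothing

  -- Coefficients are taken in 𝔽₂, so that the solver knows the characteristic.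
  open import Algebra.Solver.Ring rawRing₂ ring₂ morphism₂ _≟₂_ using (solve; _:=_; _:+_; _:*_; con; Polynomial)

  :1 : ∀ {n} → Polynomial n
  :1 = con true

  :0 : ∀ {n} → Polynomial n
  :0 = con false

  +≡0⇒≡ : ∀ {x y} → x + y ≡ 0# → x ≡ y
  +≡0⇒≡ {x} {y} eq = begin
    x            ≡⟨ solve 2 (λ x y → x := x :+ y :+ y) refl x y ⟩
    x + y + y    ≡⟨ cong (_+ y) eq ⟩
    0# + y       ≡⟨ +-identityˡ y ⟩
    y            ∎

  *-cancelˡ : ∀ {x y z} → x ≢ 0# → x * y ≡ x * z → y ≡ z
  *-cancelˡ {x} {y} {z} x≢0 eq = +≡0⇒≡ (*-cancelˡ-0 x≢0 (begin
    x * (y + z)      ≡⟨ distribˡ x y z ⟩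
    x * y + x * z    ≡⟨ cong (_+ x * z) eq ⟩
    x * z + x * z    ≡⟨ +-self _ ⟩
    0#               ∎))

  square-injective : ∀ {x y} → x * x ≡ y * y → x ≡ y
  square-injective {x} {y} eq with (x + y) ≟ 0#
  ... | yes x+y≡0 = +≡0⇒≡ x+y≡0
  ... | no  x+y≢0 = contradiction (begin
    (x + y) * (x + y)    ≡⟨ solve 2 (λ x y → (x :+ y) :* (x :+ y) := x :* x :+ y :* y) refl x y ⟩
    x * x + y * y        ≡⟨ cong (_+ y * y) eq ⟩
    y * y + y * y        ≡⟨ +-self _ ⟩
    0#                   ∎) (*-≢0 x+y≢0 x+y≢0)

  -- Total inverse with inv 0 = 0, so that inversion is an involution of the whole field.
  inv : Carrier → Carrier
  inv x with x ≟ 0#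
  ... | yes _ = 0#
  ... | no  _ = x ⁻¹

  inv-0 : inv 0# ≡ 0#
  inv-0 with 0# ≟ 0#
  ... | yes _  = refl
  ... | no 0≢0 = contradiction refl 0≢0

  inv-⁻¹ : ∀ {x} → x ≢ 0# → inv x ≡ x ⁻¹
  inv-⁻¹ {x} x≢0 with x ≟ 0#
  ... | yes x≡0 = contradiction x≡0 x≢0
  ... | no  _   = refl

  *-inv : ∀ {x} → x ≢ 0# → x * inv x ≡ 1#
  *-inv {x} x≢0 = trans (cong (x *_) (inv-⁻¹ x≢0)) (inverse x x≢0)

  inv-unique : ∀ {x y} → x * y ≡ 1# → inv x ≡ y
  inv-unique xy≡1 = *-cancelˡ x≢0 (trans (*-inv x≢0) (sym xy≡1))
    where x≢0 = *≡1⇒≢0 xy≡1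

  inv-≢0 : ∀ {x} → x ≢ 0# → inv x ≢ 0#
  inv-≢0 {x} x≢0 = *≡1⇒≢0 (trans (*-comm _ x) (*-inv x≢0))

  inv-involutive : ∀ x → inv (inv x) ≡ x
  inv-involutive x with x ≟ 0#
  ... | yes x≡0 = trans inv-0 (sym x≡0)
  ... | no  x≢0 = inv-unique (trans (*-comm _ x) (inverse x x≢0))

  inv-* : ∀ x y → inv (x * y) ≡ inv x * inv y
  inv-* x y = case x ≟ 0# of λ where
    (yes refl) → trans (trans (cong inv (zeroˡ y)) inv-0) (sym (trans (cong (_* inv y) inv-0) (zeroˡ _)))
    (no  x≢0)  → case y ≟ 0# of λ where
      (yes refl) → trans (trans (cong inv (zeroʳ x)) inv-0) (sym (trans (cong (inv x *_) inv-0) (zeroʳ _)))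
      (no  y≢0)  → inv-unique (begin
        x * y * (inv x * inv y)      ≡⟨ solve 4 (λ x y u v → x :* y :* (u :* v) := (x :* u) :* (y :* v)) refl x y (inv x) (inv y) ⟩
        (x * inv x) * (y * inv y)    ≡⟨ cong₂ _*_ (*-inv x≢0) (*-inv y≢0) ⟩
        1# * 1#                      ≡⟨ *-identityˡ 1# ⟩
        1#                           ∎)

  inv-1 : inv 1# ≡ 1#
  inv-1 = inv-unique (*-identityˡ 1#)

  *-inv-cancel : ∀ {x} y → x ≢ 0# → x * (inv x * y) ≡ y
  *-inv-cancel {x} y x≢0 = trans (sym (*-assoc x _ y)) (trans (cong (_* y) (*-inv x≢0)) (*-identityˡ y))

  inv-*-cancel : ∀ {x} y → x ≢ 0# → inv x * (x * y) ≡ y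
  inv-*-cancel {x} y x≢0 = trans (sym (*-assoc (inv x) x y))
    (trans (cong (_* y) (trans (*-comm (inv x) x) (*-inv x≢0))) (*-identityˡ y))

  -- Frobenius and trace

  -- The power x^(2^n) as iterated squaring: each step is a square by definition, so its properties
  -- follow by induction from those of squaring.
  frobenius : ℕ → Carrier → Carrier
  frobenius zero    x = x
  frobenius (suc n) x = frobenius n x * frobenius n x

  pow-+ : ∀ x k l → pow x (k ℕ.+ l) ≡ pow x k * pow x l
  pow-+ x zero    l = sym (*-identityˡ _)
  pow-+ x (suc k) l = trans (cong (x *_) (pow-+ x k l)) (sym (*-assoc x _ _))

  pow-frobenius : ∀ n x → pow x (2 ^ n) ≡ frobenius n x
  pow-frobenius zero    x = *-identityʳ x
  pow-frobenius (suc n) x = begin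
    pow x (2 ^ n ℕ.+ (2 ^ n ℕ.+ 0))    ≡⟨ cong (λ k → pow x (2 ^ n ℕ.+ k)) (ℕ.+-identityʳ (2 ^ n)) ⟩
    pow x (2 ^ n ℕ.+ 2 ^ n)            ≡⟨ pow-+ x (2 ^ n) (2 ^ n) ⟩
    pow x (2 ^ n) * pow x (2 ^ n)      ≡⟨ cong₂ _*_ (pow-frobenius n x) (pow-frobenius n x) ⟩
    frobenius n x * frobenius n x      ∎

  frobenius-+ : ∀ n x y → frobenius n (x + y) ≡ frobenius n x + frobenius n y
  frobenius-+ zero    x y = refl
  frobenius-+ (suc n) x y = trans (cong₂ _*_ (frobenius-+ n x y) (frobenius-+ n x y))
    (solve 2 (λ u v → (u :+ v) :* (u :+ v) := u :* u :+ v :* v) refl _ _)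

  frobenius-1 : ∀ n → frobenius n 1# ≡ 1#
  frobenius-1 zero    = refl
  frobenius-1 (suc n) = trans (cong₂ _*_ (frobenius-1 n) (frobenius-1 n)) (*-identityˡ 1#)

  module Product = FiniteSum E *-commutativeMonoid

  ∏-const : ∀ x → Product.∑ (λ _ → x) ≡ pow x (2 ^ m)
  ∏-const x = go (2 ^ m)
    where
    open import Algebra.Properties.CommutativeMonoid.Sum *-commutativeMonoid using (sum)
    go : ∀ n → sum {n} (λ _ → x) ≡ pow x n
    go zero    = refl
    go (suc n) = cong (x *_) (go n)

  -- Multiplication by x permutes the nonzero elements, whose product therefore equals x^(2^m - 1) times itself.
  frobenius-m : ∀ x → frobenius m x ≡ x
  frobenius-m x = trans (sym (pow-frobenius m x)) (fermat x)
    where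
    open Product using () renaming (∑ to ∏; ∑-cong to ∏-cong; ∑-distrib to ∏-distrib)

    at0 : Carrier → Carrier → Carrier → Carrier
    at0 u v y with y ≟ 0#
    ... | yes _ = u
    ... | no  _ = v

    at0-0 : ∀ u v → at0 u v 0# ≡ u
    at0-0 u v with 0# ≟ 0#
    ... | yes _  = refl
    ... | no 0≢0 = contradiction refl 0≢0

    at0-≢0 : ∀ u v {y} → y ≢ 0# → at0 u v y ≡ v
    at0-≢0 u v {y} y≢0 with y ≟ 0#
    ... | yes y≡0 = contradiction y≡0 y≢0
    ... | no  _   = refl

    -- Replacing 0 by 1 turns the product of the nonzero elements into a product over the whole
    -- field.
    unit : Carrier → Carrier
    unit y = at0 1# y y

    unit-≢0 : ∀ y → unit y ≢ 0#
    unit-≢0 y with y ≟ 0#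
    ... | yes _  = 0≢1 ∘ sym
    ... | no y≢0 = y≢0

    -- Exhibits an inverse of `∏ unit`, so that this product can be cancelled in `∏-at0`.
    ∏unit-inverse : ∏ unit * ∏ (inv ∘ unit) ≡ 1#
    ∏unit-inverse = trans (sym (∏-distrib unit (inv ∘ unit)))
      (trans (∏-cong λ y → *-inv (unit-≢0 y)) Product.∑-ε)

    module _ {x} (x≢0 : x ≢ 0#) where
      unit-* : ∀ y → unit (x * y) ≡ unit y * at0 1# x y
      unit-* y with y ≟ 0#
      ... | yes refl = trans (trans (cong unit (zeroʳ x)) (at0-0 1# 0#)) (sym (*-identityʳ 1#))
      ... | no  y≢0  = trans (at0-≢0 1# (x * y) (*-≢0 x≢0 y≢0)) (*-comm x y)

      ∏-at0 : ∏ (at0 1# x) ≡ 1#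
      ∏-at0 = *-cancelˡ (*≡1⇒≢0 ∏unit-inverse) (begin
        ∏ unit * ∏ (at0 1# x)              ≡⟨ ∏-distrib unit (at0 1# x) ⟨
        ∏ (λ y → unit y * at0 1# x y)      ≡⟨ ∏-cong unit-* ⟨
        ∏ (λ y → unit (x * y))             ≡⟨ Product.∑-reindex unit (x *_) (inv x *_)
                                                (λ y → *-inv-cancel y x≢0) (λ y → inv-*-cancel y x≢0) ⟨
        ∏ unit                             ≡⟨ *-identityʳ _ ⟨
        ∏ unit * 1#                        ∎)

      -- Splits x^(2^m) into the 2^m - 1 factors at nonzero places, whose product is 1, and the one
      -- factor at 0, which is the remaining x.
      at0-split : ∀ y → x ≡ at0 1# x y * at0 x 1# y
      at0-split y with y ≟ 0#
      ... | yes _ = sym (*-identityˡ x)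
      ... | no  _ = sym (*-identityʳ x)

      fermat-≢0 : pow x (2 ^ m) ≡ x
      fermat-≢0 = begin
        pow x (2 ^ m)                        ≡⟨ ∏-const x ⟨
        ∏ (λ _ → x)                          ≡⟨ ∏-cong at0-split ⟩
        ∏ (λ y → at0 1# x y * at0 x 1# y)    ≡⟨ ∏-distrib (at0 1# x) (at0 x 1#) ⟩
        ∏ (at0 1# x) * ∏ (at0 x 1#)          ≡⟨ cong₂ _*_ ∏-at0 (Product.∑-single (at0 x 1#) 0# λ _ → at0-≢0 x 1#) ⟩
        1# * at0 x 1# 0#                     ≡⟨ *-identityˡ _ ⟩
        at0 x 1# 0#                          ≡⟨ at0-0 x 1# ⟩
        x                                    ∎

    frobenius-0 : ∀ n → frobenius n 0# ≡ 0#
    frobenius-0 zero    = refl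
    frobenius-0 (suc n) = trans (cong (_* frobenius n 0#) (frobenius-0 n)) (zeroˡ _)

    fermat : ∀ x → pow x (2 ^ m) ≡ x
    fermat x with x ≟ 0#
    ... | yes refl = trans (pow-frobenius m 0#) (frobenius-0 m)
    ... | no  x≢0  = fermat-≢0 x≢0

  trace : ℕ → Carrier → Carrier
  trace n x = partialTrace F x n

  trace-suc : ∀ n x → trace (suc n) x ≡ frobenius n x + trace n x
  trace-suc n x = cong (_+ trace n x) (pow-frobenius n x)

  trace-+ : ∀ n x y → trace n (x + y) ≡ trace n x + trace n y
  trace-+ zero    x y = sym (+-identityʳ 0#)
  trace-+ (suc n) x y = begin
    trace (suc n) (x + y)
      ≡⟨ trace-suc n (x + y) ⟩
    frobenius n (x + y) + trace n (x + y)
      ≡⟨ cong₂ _+_ (frobenius-+ n x y) (trace-+ n x y) ⟩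
    (frobenius n x + frobenius n y) + (trace n x + trace n y)
      ≡⟨ solve 4 (λ u v s t → (u :+ v) :+ (s :+ t) := (u :+ s) :+ (v :+ t)) refl _ _ _ _ ⟩
    (frobenius n x + trace n x) + (frobenius n y + trace n y)
      ≡⟨ cong₂ _+_ (trace-suc n x) (trace-suc n y) ⟨
    trace (suc n) x + trace (suc n) y
      ∎

  -- Squaring shifts x + x² + ⋯ + x^(2^(n-1)) by one place: x^(2^n) enters and x leaves.
  trace-square : ∀ n x → trace n x * trace n x ≡ trace n x + frobenius n x + x
  trace-square zero    x = solve 1 (λ x → :0 :* :0 := :0 :+ x :+ x) refl x
  trace-square (suc n) x = begin
    trace (suc n) x * trace (suc n) x
      ≡⟨ cong₂ _*_ (trace-suc n x) (trace-suc n x) ⟩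
    (f + t) * (f + t)
      ≡⟨ solve 2 (λ f t → (f :+ t) :* (f :+ t) := f :* f :+ t :* t) refl f t ⟩
    f * f + t * t
      ≡⟨ cong (_+_ (f * f)) (trace-square n x) ⟩
    f * f + (t + f + x)
      ≡⟨ solve 3 (λ f t x → f :* f :+ (t :+ f :+ x) := (f :+ t) :+ f :* f :+ x) refl f t x ⟩
    (f + t) + f * f + x
      ≡⟨ cong (λ u → u + f * f + x) (trace-suc n x) ⟨
    trace (suc n) x + f * f + x
      ∎
    where
    f = frobenius n x
    t = trace n x

  trace-of-square : ∀ n x → trace n (x * x) ≡ trace n x * trace n x
  trace-of-square zero    x = sym (zeroˡ 0#)
  trace-of-square (suc n) x = begin
    trace (suc n) (x * x)
      ≡⟨ trace-suc n (x * x) ⟩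
    frobenius n (x * x) + trace n (x * x)
      ≡⟨ cong₂ _+_ (frobenius-square n) (trace-of-square n x) ⟩
    f * f + t * t
      ≡⟨ solve 2 (λ f t → (f :+ t) :* (f :+ t) := f :* f :+ t :* t) refl f t ⟨
    (f + t) * (f + t)
      ≡⟨ cong₂ _*_ (trace-suc n x) (trace-suc n x) ⟨
    trace (suc n) x * trace (suc n) x
      ∎
    where
    f = frobenius n x
    t = trace n x
    frobenius-square : ∀ n → frobenius n (x * x) ≡ frobenius n x * frobenius n x
    frobenius-square zero    = refl
    frobenius-square (suc n) = cong₂ _*_ (frobenius-square n) (frobenius-square n)

  Tr-+ : ∀ x y → Tr (x + y) ≡ Tr x + Tr y
  Tr-+ = trace-+ m

  -- For n = m the two boundary terms of `trace-square` cancel by Fermat. An idempotent of a field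
  -- is 0 or 1, so the trace lies in 𝔽₂.
  Tr-idempotent : ∀ x → Tr x * Tr x ≡ Tr x
  Tr-idempotent x = begin
    Tr x * Tr x                   ≡⟨ trace-square m x ⟩
    Tr x + frobenius m x + x      ≡⟨ cong (λ u → Tr x + u + x) (frobenius-m x) ⟩
    Tr x + x + x                  ≡⟨ solve 2 (λ t x → t :+ x :+ x := t) refl (Tr x) x ⟩
    Tr x                          ∎

  Tr-square : ∀ x → Tr (x * x) ≡ Tr x
  Tr-square x = trans (trace-of-square m x) (Tr-idempotent x)

  Tr≢0⇒Tr≡1 : ∀ {x} → Tr x ≢ 0# → Tr x ≡ 1#
  Tr≢0⇒Tr≡1 {x} Tr≢0 = *-cancelˡ Tr≢0 (trans (Tr-idempotent x) (sym (*-identityʳ _)))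

  -- Polynomial functions of degree at most n with x^n-coefficient c, characterised by their divided differences.
  IsPolynomial : ℕ → Carrier → (Carrier → Carrier) → Set
  IsPolynomial zero    c f = ∀ x → f x ≡ c
  IsPolynomial (suc n) c f = ∀ r → Σ (Carrier → Carrier) λ g → IsPolynomial n c g × (∀ x → f x ≡ f r + (x + r) * g x)

  poly-+ : ∀ n {c d f g} → IsPolynomial n c f → IsPolynomial n d g → IsPolynomial n (c + d) (λ x → f x + g x)
  poly-+ zero    p q x = cong₂ _+_ (p x) (q x)
  poly-+ (suc n) p q r with p r | q r
  ... | f′ , p′ , eq | g′ , q′ , eq′ = (λ x → f′ x + g′ x) , poly-+ n p′ q′ , λ x → trans (cong₂ _+_ (eq x) (eq′ x))
    (solve 6 (λ a b x r s t → (a :+ (x :+ r) :* s) :+ (b :+ (x :+ r) :* t) := (a :+ b) :+ (x :+ r) :* (s :+ t)) refl _ _ x r (f′ x) (g′ x))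

  poly-scale : ∀ n k {c f} → IsPolynomial n c f → IsPolynomial n (k * c) (λ x → k * f x)
  poly-scale zero    k p x = cong (k *_) (p x)
  poly-scale (suc n) k p r with p r
  ... | f′ , p′ , eq = (λ x → k * f′ x) , poly-scale n k p′ , λ x → trans (cong (k *_) (eq x))
    (solve 5 (λ k a x r s → k :* (a :+ (x :+ r) :* s) := k :* a :+ (x :+ r) :* (k :* s)) refl k _ x r (f′ x))

  poly-raise : ∀ n {c f} → IsPolynomial n c f → IsPolynomial (suc n) 0# f
  poly-raise zero    {c} {f} p r = (λ _ → 0#) , (λ _ → refl) , λ x → trans (trans (p x) (sym (p r)))
    (solve 3 (λ a x r → a := a :+ (x :+ r) :* :0) refl (f r) x r)
  poly-raise (suc n) p r with p r
  ... | f′ , p′ , eq = f′ , poly-raise n p′ , eq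

  poly-raise-< : ∀ {n k c f} → n ℕ.<′ k → IsPolynomial n c f → IsPolynomial k 0# f
  poly-raise-< ℕ.<′-base        p = poly-raise _ p
  poly-raise-< (ℕ.<′-step n<k) p = poly-raise _ (poly-raise-< n<k p)

  poly-x* : ∀ n {c f} → IsPolynomial n c f → IsPolynomial (suc n) c (λ x → x * f x)
  poly-x* zero    {c} {f} p r = f , p , λ x → trans (cong (x *_) (trans (p x) (sym (p r)))) (trans
    (solve 3 (λ x r a → x :* a := r :* a :+ (x :+ r) :* a) refl x r (f r))
    (cong (λ u → r * f r + (x + r) * u) (trans (p r) (sym (p x)))))
  poly-x* (suc n) {c} {f} p r with p r
  -- Since x f(x) - r f(r) = (x - r) f(x) + r (f(x) - f(r)), the divided difference is f(x) + r
  -- f′(x). Its second summand has lower degree and is padded with leading coefficient 0.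
  ... | f′ , p′ , eq = (λ x → f x + r * f′ x)
    , subst (λ u → IsPolynomial (suc n) u (λ x → f x + r * f′ x)) (solve 2 (λ c r → c :+ r :* :0 := c) refl c r)
        (poly-+ (suc n) p (poly-scale (suc n) r (poly-raise n p′)))
    , λ x → begin
        x * f x                                            ≡⟨ solve 3 (λ x r a → x :* a := r :* a :+ (x :+ r) :* a) refl x r (f x) ⟩
        r * f x + (x + r) * f x                            ≡⟨ cong (λ u → r * u + (x + r) * f x) (eq x) ⟩
        r * (f r + (x + r) * f′ x) + (x + r) * f x         ≡⟨ solve 5 (λ x r a s b → r :* (a :+ (x :+ r) :* s) :+ (x :+ r) :* b := r :* a :+ (x :+ r) :* (b :+ r :* s)) refl x r (f r) (f′ x) (f x) ⟩
        r * f r + (x + r) * (f x + r * f′ x)               ∎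

  poly-pow : ∀ n → IsPolynomial n 1# (λ x → pow x n)
  poly-pow zero    x = refl
  poly-pow (suc n) = poly-x* n (poly-pow n)

  poly-trace : ∀ n → IsPolynomial (2 ^ n) 1# (trace (suc n))
  poly-trace zero    = subst (λ u → IsPolynomial 1 u (trace 1)) (+-identityʳ 1#)
    (poly-+ 1 (poly-pow 1) (poly-raise 0 λ _ → refl))
  poly-trace (suc n) = subst (λ u → IsPolynomial (2 ^ suc n) u (trace (suc (suc n)))) (+-identityʳ 1#)
    (poly-+ (2 ^ suc n) (poly-pow (2 ^ suc n))
      (poly-raise-< (ℕ.<⇒<′ (ℕ.^-monoʳ-< 2 (s≤s (s≤s z≤n)) (ℕ.n<1+n n))) (poly-trace n)))

  -- The divided difference at one root keeps the leading coefficient and vanishes at the other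
  -- roots; after n steps a constant with a root is left.
  poly-roots : ∀ n {c f} → IsPolynomial n c f → (e : Fin (suc n) → Carrier) → (∀ i j → e i ≡ e j → i ≡ j) →
               (∀ i → f (e i) ≡ 0#) → c ≡ 0#
  poly-roots zero    p e e-inj roots = trans (sym (p _)) (roots Fin.zero)
  poly-roots (suc n) {c} {f} p e e-inj roots with p (e Fin.zero)
  ... | g , q , eq = poly-roots n q (e ∘ Fin.suc) (λ i j → Fin.suc-injective ∘ e-inj _ _)
    λ i → *-cancelˡ-0 (distinct i) (begin
      (e (Fin.suc i) + r) * g (e (Fin.suc i))          ≡⟨ +-identityˡ _ ⟨
      0# + (e (Fin.suc i) + r) * g (e (Fin.suc i))     ≡⟨ cong (_+ (e (Fin.suc i) + r) * g (e (Fin.suc i))) (roots Fin.zero) ⟨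
      f r + (e (Fin.suc i) + r) * g (e (Fin.suc i))    ≡⟨ eq _ ⟨
      f (e (Fin.suc i))                                ≡⟨ roots (Fin.suc i) ⟩
      0#                                               ∎)
    where
    r = e Fin.zero
    distinct : ∀ i → e (Fin.suc i) + r ≢ 0#
    distinct i eq with () ← e-inj (Fin.suc i) Fin.zero (+≡0⇒≡ eq)

  -- Surjectivity of the trace and Artin-Schreier equations

  Tr-surjective : ∃ λ θ → Tr θ ≡ 1#
  Tr-surjective = to i , Tr≢0⇒Tr≡1 Tr≢0
    where
    -- The trace is a polynomial of degree 2^(m-1) with leading coefficient 1, so it cannot vanish
    -- at all 2^m elements.
    ¬Tr≡0 : ¬ (∀ i → Tr (to i) ≡ 0#)
    ¬Tr≡0 Tr≡0 = lemma 1≤m refl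
      where
      -- The equation with `m` takes the place of a case split on `m`, on which `F` depends.
      lemma : ∀ {k} → 1 ≤ k → k ≢ m
      lemma {suc k} _ k≡m = 0≢1 (sym (poly-roots (2 ^ k) (poly-trace k) (λ i → to (Fin.inject≤ i 2^k<2^m)) inj
        λ i → trans (cong (λ n → trace n (to (Fin.inject≤ i 2^k<2^m))) k≡m) (Tr≡0 _)))
        where
        2^k<2^m : 2 ^ k ℕ.< 2 ^ m
        2^k<2^m = subst (λ n → 2 ^ k ℕ.< 2 ^ n) k≡m (ℕ.^-monoʳ-< 2 (s≤s (s≤s z≤n)) (ℕ.n<1+n k))

        inj : ∀ i j → to (Fin.inject≤ i 2^k<2^m) ≡ to (Fin.inject≤ j 2^k<2^m) → i ≡ j
        inj i j eq = Fin.inject≤-injective _ _ i j (trans (sym (strictlyInverseʳ _)) (trans (cong from eq) (strictlyInverseʳ _)))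

    Tr≢0-somewhere : ∃ λ i → Tr (to i) ≢ 0#
    Tr≢0-somewhere = Fin.¬∀⟶∃¬ (2 ^ m) (λ i → Tr (to i) ≡ 0#) (λ i → Tr (to i) ≟ 0#) ¬Tr≡0

    i = proj₁ Tr≢0-somewhere
    Tr≢0 = proj₂ Tr≢0-somewhere

  -- Additive Hilbert 90, with the usual solution z = ∑ᵢ (d + d² + ⋯ + d^(2^(i-1))) θ^(2^i), where Tr θ = 1.
  artin-schreier : ∀ d → Tr d ≡ 0# → ∃ λ z → z * z + z ≡ d
  artin-schreier d Tr≡0 = Z m , (begin
    Z m * Z m + Z m                             ≡⟨ cong (_+ Z m) (Z-square m) ⟩
    Tr d * frobenius m θ + Z m + d * (trace (suc m) θ + θ) + Z m
      ≡⟨ cong₂ (λ s t → s * frobenius m θ + Z m + d * (t + θ) + Z m) Tr≡0 (trans (trace-suc m θ) (cong₂ _+_ (frobenius-m θ) Trθ≡1)) ⟩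
    0# * frobenius m θ + Z m + d * (θ + 1# + θ) + Z m
      ≡⟨ solve 4 (λ f z d θ → :0 :* f :+ z :+ d :* (θ :+ :1 :+ θ) :+ z := d) refl (frobenius m θ) (Z m) d θ ⟩
    d                                           ∎)
    where
    θ = proj₁ Tr-surjective
    Trθ≡1 = proj₂ Tr-surjective

    Z : ℕ → Carrier
    Z zero    = 0#
    Z (suc n) = trace n d * frobenius n θ + Z n

    -- Let tᵢ be the i-th partial trace of d. Squaring turns tᵢ θ^(2^i) into (tᵢ₊₁ + d) θ^(2^(i+1));
    -- the tᵢ₊₁ parts form `Z (suc n)`, and the d parts add up to d (θ² + ⋯ + θ^(2^n)).
    Z-square : ∀ n → Z n * Z n ≡ Z (suc n) + d * (trace (suc n) θ + θ)
    Z-square zero    = trans (solve 2 (λ d θ → :0 :* :0 := :0 :* θ :+ :0 :+ d :* (θ :+ :0 :+ θ)) refl d θ)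
      (cong (λ u → 0# * θ + 0# + d * (u + θ)) (sym (trace-suc 0 θ)))
    Z-square (suc n) = begin
      (t * f + Z n) * (t * f + Z n)
        ≡⟨ solve 3 (λ t f z → (t :* f :+ z) :* (t :* f :+ z) := t :* t :* (f :* f) :+ z :* z) refl t f (Z n) ⟩
      t * t * (f * f) + Z n * Z n
        ≡⟨ cong₂ (λ u v → u * (f * f) + v) (trace-square n d) (Z-square n) ⟩
      (t + frobenius n d + d) * (f * f) + (Z (suc n) + d * (trace (suc n) θ + θ))
        ≡⟨ solve 7 (λ t f g d z s θ → (t :+ g :+ d) :* (f :* f) :+ (z :+ d :* (s :+ θ))
                     := (g :+ t) :* (f :* f) :+ z :+ d :* ((f :* f :+ s) :+ θ)) refl t f (frobenius n d) d (Z (suc n)) (trace (suc n) θ) θ ⟩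
      (frobenius n d + t) * (f * f) + Z (suc n) + d * ((f * f + trace (suc n) θ) + θ)
        ≡⟨ cong₂ (λ u v → u * (f * f) + Z (suc n) + d * (v + θ)) (trace-suc n d) (trace-suc (suc n) θ) ⟨
      Z (suc (suc n)) + d * (trace (suc (suc n)) θ + θ)
        ∎
      where
      t = trace n d
      f = frobenius n θ

  -- Kloosterman sums

  sgn-Tr≡0 : ∀ x → Tr x ≡ 0# → sgn x ≡ + 1
  sgn-Tr≡0 x Tr≡0 with Tr x ≟ 0#
  ... | yes _   = refl
  ... | no Tr≢0 = contradiction Tr≡0 Tr≢0

  sgn-Tr≢0 : ∀ x → Tr x ≢ 0# → sgn x ≡ ℤ.-1ℤ
  sgn-Tr≢0 x Tr≢0 with Tr x ≟ 0#
  ... | yes Tr≡0 = contradiction Tr≡0 Tr≢0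
  ... | no _     = refl

  sgn-cong-Tr : ∀ x y → Tr x ≡ Tr y → sgn x ≡ sgn y
  sgn-cong-Tr x y eq with Tr y ≟ 0#
  ... | yes Tr≡0 = sgn-Tr≡0 x (trans eq Tr≡0)
  ... | no  Tr≢0 = sgn-Tr≢0 x (Tr≢0 ∘ trans (sym eq))

  sgn-square : ∀ x → sgn (x * x) ≡ sgn x
  sgn-square x = sgn-cong-Tr (x * x) x (Tr-square x)

  sgn-+ : ∀ x y → sgn (x + y) ≡ sgn x ℤ.* sgn y
  sgn-+ x y with Tr x ≟ 0# | Tr y ≟ 0#
  ... | yes p | yes q = sgn-Tr≡0 (x + y) (trans (Tr-+ x y) (trans (cong₂ _+_ p q) (+-identityʳ 0#)))
  ... | yes p | no  q = sgn-Tr≢0 (x + y) λ eq → q (trans (sym (trans (Tr-+ x y) (trans (cong (_+ Tr y) p) (+-identityˡ _)))) eq)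
  ... | no  p | yes q = sgn-Tr≢0 (x + y) λ eq → p (trans (sym (trans (Tr-+ x y) (trans (cong (_+_ (Tr x)) q) (+-identityʳ _)))) eq)
  ... | no  p | no  q = sgn-Tr≡0 (x + y) (trans (Tr-+ x y) (trans (cong₂ _+_ (Tr≢0⇒Tr≡1 p) (Tr≢0⇒Tr≡1 q)) 1+1≡0))

  sgn-self : ∀ x → sgn x ℤ.* sgn x ≡ + 1
  sgn-self x with Tr x ≟ 0#
  ... | yes _ = refl
  ... | no  _ = refl

  -- Solutions come in pairs w, w + 1. Tr(z² + z) = 0 makes Tr(d) = 0 necessary, and
  -- `artin-schreier` makes it sufficient.
  ∑-artin-schreier : ∀ d → ∑ (λ z → indicator ((z * z + z) ≟ d)) ≡ + 1 ℤ.+ sgn d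
  ∑-artin-schreier d = case Tr d ≟ 0# of λ where
      (yes Tr≡0) → trans (solvable (artin-schreier d Tr≡0)) (cong (ℤ._+_ (+ 1)) (sym (sgn-Tr≡0 d Tr≡0)))
      (no  Tr≢0) → trans
        (trans (∑-cong λ z → indicator-no ((z * z + z) ≟ d) λ eq → Tr≢0 (trans (cong Tr (sym eq)) (Tr-image z))) ∑-ε)
        (cong (ℤ._+_ (+ 1)) (sym (sgn-Tr≢0 d Tr≢0)))
    where
    Tr-image : ∀ z → Tr (z * z + z) ≡ 0#
    Tr-image z = trans (Tr-+ (z * z) z) (trans (cong (_+ Tr z) (Tr-square z)) (+-self (Tr z)))

    solvable : (∃ λ w → w * w + w ≡ d) → ∑ (λ z → indicator ((z * z + z) ≟ d)) ≡ + 2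
    solvable (w , w-root) = begin
      ∑ (λ z → indicator ((z * z + z) ≟ d))                          ≡⟨ ∑-cong two-roots ⟩
      ∑ (λ z → indicator (z ≟ w) ℤ.+ indicator (z ≟ (w + 1#)))       ≡⟨ ∑-distrib (λ z → indicator (z ≟ w)) (λ z → indicator (z ≟ (w + 1#))) ⟩
      ∑ (λ z → indicator (z ≟ w)) ℤ.+ ∑ (λ z → indicator (z ≟ (w + 1#))) ≡⟨ cong₂ ℤ._+_ (∑-indicator w) (∑-indicator (w + 1#)) ⟩
      + 2                                                            ∎
      where
      w+1-root : (w + 1#) * (w + 1#) + (w + 1#) ≡ d
      w+1-root = trans (solve 1 (λ w → (w :+ :1) :* (w :+ :1) :+ (w :+ :1) := w :* w :+ w) refl w) w-root

      root : ∀ z → z * z + z ≡ d → z ≢ w → z ≡ w + 1#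
      root z z-root z≢w = +≡0⇒≡ (*-cancelˡ-0 (z≢w ∘ +≡0⇒≡) (begin
        (z + w) * (z + (w + 1#))       ≡⟨ solve 2 (λ z w → (z :+ w) :* (z :+ (w :+ :1)) := (z :* z :+ z) :+ (w :* w :+ w)) refl z w ⟩
        (z * z + z) + (w * w + w)      ≡⟨ cong₂ _+_ z-root w-root ⟩
        d + d                          ≡⟨ +-self d ⟩
        0#                             ∎))

      w≢w+1 : w ≢ w + 1#
      w≢w+1 eq = 0≢1 (begin
        0#               ≡⟨ +-self w ⟨
        w + w            ≡⟨ cong (_+_ w) eq ⟩
        w + (w + 1#)     ≡⟨ solve 1 (λ w → w :+ (w :+ :1) := :1) refl w ⟩
        1#               ∎)

      two-roots : ∀ z → indicator ((z * z + z) ≟ d) ≡ indicator (z ≟ w) ℤ.+ indicator (z ≟ (w + 1#))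
      two-roots z with z ≟ w
      ... | yes refl = trans (indicator-yes ((z * z + z) ≟ d) w-root)
                         (cong (ℤ._+_ (+ 1)) (sym (indicator-no (z ≟ (w + 1#)) w≢w+1)))
      ... | no  z≢w  = trans (indicator-cong ((z * z + z) ≟ d) (z ≟ (w + 1#)) (λ eq → root z eq z≢w)
                         (λ where refl → w+1-root)) (sym (ℤ.+-identityˡ _))

  -- The summand of K is a local function in Defs; it is recovered by unification.
  mutual
    kloosterman : Carrier → Carrier → ℤ
    kloosterman c x = _

    K≡∑ : ∀ c → K c ≡ ∑ (kloosterman c)
    K≡∑ c = ∑-foldr (kloosterman c)

  kloosterman-0 : ∀ c → kloosterman c 0# ≡ + 0
  kloosterman-0 c with 0# ≟ 0#
  ... | yes _  = refl
  ... | no 0≢0 = contradiction refl 0≢0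

  kloosterman-≢0 : ∀ c {x} → x ≢ 0# → kloosterman c x ≡ sgn (c * x + inv x)
  kloosterman-≢0 c {x} x≢0 with x ≟ 0#
  ... | yes x≡0 = contradiction x≡0 x≢0
  ... | no  _   = refl

  -- The nonzero x with Tr (c x + 1/x) = 1 are permuted without fixed points by x ↦ 1/(c x).
  4∣K+1-2^m : ∀ c → c ≢ 0# → + 4 S.∣ K c ℤ.+ + 1 - + (2 ^ m)
  4∣K+1-2^m c c≢0 = multiple (involution⇒2∣∑ minus σ σσ minus-σ minus-fixed)
    where
    arg : Carrier → Carrier
    arg x = c * x + inv x

    minus : Carrier → ℤ
    minus x = nonzero x ℤ.* (+ 1 - indicator (Tr (arg x) ≟ 0#))

    σ : Carrier → Carrier
    σ x = inv c * inv x

    inv-σ : ∀ x → inv (σ x) ≡ c * x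
    inv-σ x = trans (inv-* (inv c) (inv x)) (cong₂ _*_ (inv-involutive c) (inv-involutive x))

    σσ : ∀ x → σ (σ x) ≡ x
    σσ x = trans (cong (inv c *_) (inv-σ x)) (inv-*-cancel x c≢0)

    arg-σ : ∀ x → arg (σ x) ≡ arg x
    arg-σ x = trans (cong₂ _+_ (*-inv-cancel (inv x) c≢0) (inv-σ x)) (solve 2 (λ u v → u :+ v := v :+ u) refl _ _)

    nonzero-σ : ∀ x → nonzero (σ x) ≡ nonzero x
    nonzero-σ x = cong (_-_ (+ 1)) (indicator-cong (σ x ≟ 0#) (x ≟ 0#)
      (λ eq → trans (sym (inv-involutive x)) (trans (cong inv (*-cancelˡ-0 (inv-≢0 c≢0) eq)) inv-0))
      (λ where refl → trans (cong (inv c *_) inv-0) (zeroʳ _)))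

    minus-σ : ∀ x → minus (σ x) ≡ minus x
    minus-σ x = cong₂ (λ u v → u ℤ.* (+ 1 - indicator (Tr v ≟ 0#))) (nonzero-σ x) (arg-σ x)

    -- At a fixed point c x = 1/x, so the argument c x + 1/x is 0 and has trace 0. With
    -- `inv 0# ≡ 0#` this covers x = 0 too.
    minus-fixed : ∀ x → σ x ≡ x → minus x ≡ + 0
    minus-fixed x σx≡x = trans
      (cong (λ u → nonzero x ℤ.* (+ 1 - u)) (indicator-yes (Tr (arg x) ≟ 0#) Tr≡0)) (ℤ.*-zeroʳ (nonzero x))
      where
      Tr-0 : Tr 0# ≡ 0#
      Tr-0 = trans (cong Tr (sym (+-self 0#))) (trans (Tr-+ 0# 0#) (+-self (Tr 0#)))

      Tr≡0 : Tr (arg x) ≡ 0#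
      Tr≡0 = trans (cong (λ u → Tr (c * u + inv x)) (sym σx≡x))
        (trans (cong (λ u → Tr (u + inv x)) (*-inv-cancel (inv x) c≢0)) (trans (cong Tr (+-self (inv x))) Tr-0))

    -- The two outer occurrences of `+ 1` stand where `split` has `nonzero x`.
    sgn-indicator : ∀ y → sgn y ≡ + 1 ℤ.+ ℤ.- + 2 ℤ.* (+ 1 ℤ.* (+ 1 - indicator (Tr y ≟ 0#)))
    sgn-indicator y with Tr y ≟ 0#
    ... | yes _ = refl
    ... | no  _ = refl

    split : ∀ x → kloosterman c x ≡ nonzero x ℤ.+ ℤ.- + 2 ℤ.* minus x
    split x = case x ≟ 0# of λ where
      (yes refl) → trans (kloosterman-0 c) (cong (λ u → u ℤ.+ ℤ.- + 2 ℤ.* (u ℤ.* (+ 1 - indicator (Tr (arg 0#) ≟ 0#))))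
                     (sym (cong (_-_ (+ 1)) (indicator-yes (0# ≟ 0#) refl))))
      (no  x≢0)  → trans (trans (kloosterman-≢0 c x≢0) (sgn-indicator (arg x)))
                     (cong (λ u → u ℤ.+ ℤ.- + 2 ℤ.* (u ℤ.* (+ 1 - indicator (Tr (arg x) ≟ 0#))))
                     (sym (cong (_-_ (+ 1)) (indicator-no (x ≟ 0#) x≢0))))

    K-minus : K c ≡ (+ (2 ^ m) - + 1) ℤ.+ ℤ.- + 2 ℤ.* ∑ minus
    K-minus = begin
      K c                                                     ≡⟨ K≡∑ c ⟩
      ∑ (kloosterman c)                                       ≡⟨ ∑-cong split ⟩
      ∑ (λ x → nonzero x ℤ.+ ℤ.- + 2 ℤ.* minus x)             ≡⟨ ∑-distrib nonzero (λ x → ℤ.- + 2 ℤ.* minus x) ⟩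
      ∑ nonzero ℤ.+ ∑ (λ x → ℤ.- + 2 ℤ.* minus x)             ≡⟨ cong₂ ℤ._+_ ∑-nonzero (∑-*ˡ (ℤ.- + 2) minus) ⟩
      (+ (2 ^ m) - + 1) ℤ.+ ℤ.- + 2 ℤ.* ∑ minus               ∎

    multiple : + 2 S.∣ ∑ minus → + 4 S.∣ K c ℤ.+ + 1 - + (2 ^ m)
    multiple (S.divides q ∑≡q*2) = S.divides (ℤ.- q) (begin
      K c ℤ.+ + 1 - N                                              ≡⟨ cong (λ k → k ℤ.+ + 1 - N) (trans K-minus (cong (λ u → (N - + 1) ℤ.+ ℤ.- + 2 ℤ.* u) ∑≡q*2)) ⟩
      (N - + 1) ℤ.+ ℤ.- + 2 ℤ.* (q ℤ.* + 2) ℤ.+ + 1 - N            ≡⟨ identity N q ⟩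
      ℤ.- q ℤ.* + 4                                                ∎)
      where
      N = + (2 ^ m)
      identity : ∀ n q → (n - + 1) ℤ.+ ℤ.- + 2 ℤ.* (q ℤ.* + 2) ℤ.+ + 1 - n ≡ ℤ.- q ℤ.* + 4
      identity = ℤ-Solver.solve-∀

  -- Counting points on the cubic

  module Curve (a : Carrier) (a≢0 : a ≢ 0#) (a≢1 : a ≢ 1#) where

    curve : Carrier → Carrier → ℤ
    curve p q = indicator ((p * q * (p + q + 1#)) ≟ (a * a))

    3∣∑∑curve : + 3 S.∣ ∑ (λ p → ∑ (curve p))
    3∣∑∑curve = rotation⇒3∣∑∑ curve (λ p q → p + q + 1#)
      (solve 2 (λ p q → q :+ (p :+ q :+ :1) :+ :1 := p) refl)
      (λ p q → cong (λ u → indicator (u ≟ (a * a)))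
        (solve 2 (λ p q → q :* (p :+ q :+ :1) :* (q :+ (p :+ q :+ :1) :+ :1) := p :* q :* (p :+ q :+ :1)) refl p q))
      -- In characteristic 2 a fixed pair has p = p + p + 1 = 1, and the equation becomes 1 = a².
      λ p p+p+1≡p → indicator-no ((p * p * (p + p + 1#)) ≟ (a * a)) λ eq →
        a≢1 (square-injective (trans (sym eq) (trans
          (cong (λ u → u * u * (u + u + 1#)) (trans (sym p+p+1≡p) (solve 1 (λ p → p :+ p :+ :1 := :1) refl p)))
          (solve 0 (:1 :* :1 :* (:1 :+ :1 :+ :1) := :1 :* :1) refl))))

    ∑-curve-0 : ∑ (curve 0#) ≡ + 0
    ∑-curve-0 = trans (∑-cong λ q → indicator-no ((0# * q * (0# + q + 1#)) ≟ (a * a)) λ eq →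
      *-≢0 a≢0 a≢0 (trans (sym eq) (solve 1 (λ q → :0 :* q :* (:0 :+ q :+ :1) := :0) refl q))) ∑-ε

    -- At p = 1 the term linear in q drops out, and q² = a² has the single root a because squaring
    -- is injective.
    ∑-curve-1 : ∑ (curve 1#) ≡ + 1
    ∑-curve-1 = trans (∑-cong λ q → indicator-cong ((1# * q * (1# + q + 1#)) ≟ (a * a)) (q ≟ a)
      (λ eq → square-injective (trans (sym (square q)) eq)) (λ where refl → square q)) (∑-indicator a)
      where
      square : ∀ q → 1# * q * (1# + q + 1#) ≡ q * q
      square = solve 1 (λ q → :1 :* q :* (:1 :+ q :+ :1) := q :* q) refl

    -- The substitution q = (p + 1) z turns the equation for q into z² + z = d.
    ∑-curve : ∀ p d → p ≢ 0# → p + 1# ≢ 0# → d * (p * ((p + 1#) * (p + 1#))) ≡ a * a → ∑ (curve p) ≡ + 1 ℤ.+ sgn d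
    ∑-curve p d p≢0 s≢0 dps²≡a² = begin
      ∑ (curve p)                                 ≡⟨ ∑-reindex (curve p) (s *_) (inv s *_)
                                                       (λ q → *-inv-cancel q s≢0) (λ z → inv-*-cancel z s≢0) ⟩
      ∑ (λ z → curve p (s * z))                   ≡⟨ ∑-cong transform ⟩
      ∑ (λ z → indicator ((z * z + z) ≟ d))       ≡⟨ ∑-artin-schreier d ⟩
      + 1 ℤ.+ sgn d                               ∎
      where
      s = p + 1#
      a² : p * (s * s) * d ≡ a * a
      a² = trans (*-comm _ d) dps²≡a²
      substitute : ∀ z → p * (s * z) * (p + s * z + 1#) ≡ p * (s * s) * (z * z + z)
      substitute = solve 2 (λ p z → p :* ((p :+ :1) :* z) :* (p :+ (p :+ :1) :* z :+ :1)
                                      := p :* ((p :+ :1) :* (p :+ :1)) :* (z :* z :+ z)) refl p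
      transform : ∀ z → curve p (s * z) ≡ indicator ((z * z + z) ≟ d)
      transform z = indicator-cong ((p * (s * z) * (p + s * z + 1#)) ≟ (a * a)) ((z * z + z) ≟ d)
        (λ eq → *-cancelˡ (*-≢0 p≢0 (*-≢0 s≢0 s≢0)) (trans (sym (substitute z)) (trans eq (sym a²))))
        (λ eq → trans (substitute z) (trans (cong (p * (s * s) *_) eq) a²))

    -- Under the trace, a²/w + a²/w² amounts to (a² + a)/w. Setting w = e x with e = a² + a makes
    -- this 1/x and turns a² w into c x.
    e c : Carrier
    e = a * a + a
    c = a * a * e

    e≢0 : e ≢ 0#
    e≢0 eq = a≢1 (*-cancelˡ a≢0 (trans (+≡0⇒≡ eq) (sym (*-identityʳ a))))

    -- By `inv 0# ≡ 0#` this permutes the whole field: x = 0 goes to p = 1 and x = 1/e to p = 0, the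
    -- two values that `∑-curve` excludes.
    φ : Carrier → Carrier
    φ x = inv (1# + e * x)

    -- With w = e x and p = φ x = 1/(1 + w), partial fractions give a²/(p (p+1)²) = a² (w + 1 + 1/w + 1/w²).
    ∑-curve-φ : ∀ x → ∑ (curve (φ x)) ≡ + 1 ℤ.+ (sgn a ℤ.* kloosterman c x ℤ.+ ℤ.- + 2 ℤ.* indicator (x ≟ inv e))
    ∑-curve-φ x = case x ≟ 0# of λ where
        (yes refl) → begin
          ∑ (curve (φ 0#))    ≡⟨ cong (λ p → ∑ (curve p)) (trans (cong inv (solve 1 (λ e → :1 :+ e :* :0 := :1) refl e)) inv-1) ⟩
          ∑ (curve 1#)        ≡⟨ ∑-curve-1 ⟩
          + 1 ℤ.+ (+ 0 ℤ.+ ℤ.- + 2 ℤ.* + 0)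
            ≡⟨ cong₂ (λ u v → + 1 ℤ.+ (u ℤ.+ ℤ.- + 2 ℤ.* v)) (sym (trans (cong (ℤ._*_ (sgn a)) (kloosterman-0 c)) (ℤ.*-zeroʳ (sgn a))))
                 (sym (indicator-no (0# ≟ inv e) (inv-≢0 e≢0 ∘ sym))) ⟩
          + 1 ℤ.+ (sgn a ℤ.* kloosterman c 0# ℤ.+ ℤ.- + 2 ℤ.* indicator (0# ≟ inv e)) ∎
        (no x≢0) → case x ≟ inv e of λ where
          (yes refl) → at-inv
          (no  x≢e⁻¹) → generic x≢0 x≢e⁻¹
      where
      -- Here c x + 1/x = a² + e = a, so the Kloosterman term times `sgn a` is 1 and would predict
      -- two points; the fibre over p = 0 is empty, whence the correction by -2.
      at-inv : ∑ (curve (φ (inv e))) ≡ + 1 ℤ.+ (sgn a ℤ.* kloosterman c (inv e) ℤ.+ ℤ.- + 2 ℤ.* indicator (inv e ≟ inv e))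
      at-inv = begin
        ∑ (curve (φ (inv e)))    ≡⟨ cong (λ p → ∑ (curve p)) (trans (cong inv (trans (cong (_+_ 1#) (*-inv e≢0)) 1+1≡0)) inv-0) ⟩
        ∑ (curve 0#)             ≡⟨ ∑-curve-0 ⟩
        + 1 ℤ.+ (+ 1 ℤ.+ ℤ.- + 2 ℤ.* + 1)
          ≡⟨ cong₂ (λ u v → + 1 ℤ.+ (u ℤ.+ ℤ.- + 2 ℤ.* v)) (sym (trans (cong (ℤ._*_ (sgn a)) term) (sgn-self a)))
               (sym (indicator-yes (inv e ≟ inv e) refl)) ⟩
        + 1 ℤ.+ (sgn a ℤ.* kloosterman c (inv e) ℤ.+ ℤ.- + 2 ℤ.* indicator (inv e ≟ inv e)) ∎
        where
        term : kloosterman c (inv e) ≡ sgn a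
        term = trans (kloosterman-≢0 c (inv-≢0 e≢0)) (cong sgn (begin
          a * a * e * inv e + inv (inv e)      ≡⟨ cong₂ _+_ (*-assoc _ _ _) (inv-involutive e) ⟩
          a * a * (e * inv e) + (a * a + a)    ≡⟨ cong (λ u → a * a * u + (a * a + a)) (*-inv e≢0) ⟩
          a * a * 1# + (a * a + a)             ≡⟨ solve 1 (λ a → a :* a :* :1 :+ (a :* a :+ a) := a) refl a ⟩
          a                                    ∎))

      generic : x ≢ 0# → x ≢ inv e → ∑ (curve (φ x)) ≡ + 1 ℤ.+ (sgn a ℤ.* kloosterman c x ℤ.+ ℤ.- + 2 ℤ.* indicator (x ≟ inv e))
      generic x≢0 x≢e⁻¹ = begin
        ∑ (curve u)                  ≡⟨ ∑-curve u d (inv-≢0 1+w≢0) (*-≢0 w≢0 (inv-≢0 1+w≢0) ∘ trans (sym u+1)) d-eq ⟩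
        + 1 ℤ.+ sgn d                ≡⟨ cong (ℤ._+_ (+ 1)) sgn-d ⟩
        + 1 ℤ.+ sgn a ℤ.* kloosterman c x
          ≡⟨ cong (ℤ._+_ (+ 1)) (sym (ℤ.+-identityʳ (sgn a ℤ.* kloosterman c x))) ⟩
        + 1 ℤ.+ (sgn a ℤ.* kloosterman c x ℤ.+ ℤ.- + 2 ℤ.* + 0)
          ≡⟨ cong (λ v → + 1 ℤ.+ (sgn a ℤ.* kloosterman c x ℤ.+ ℤ.- + 2 ℤ.* v)) (sym (indicator-no (x ≟ inv e) x≢e⁻¹)) ⟩
        + 1 ℤ.+ (sgn a ℤ.* kloosterman c x ℤ.+ ℤ.- + 2 ℤ.* indicator (x ≟ inv e)) ∎
        where
        w = e * x
        u = inv (1# + w)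
        y = inv w
        d = a * a * w + a * a + a * a * y + (a * y) * (a * y)

        w≢0 : w ≢ 0#
        w≢0 = *-≢0 e≢0 x≢0

        1+w≢0 : 1# + w ≢ 0#
        1+w≢0 eq = x≢e⁻¹ (sym (inv-unique (sym (+≡0⇒≡ eq))))

        u+1 : u + 1# ≡ w * u
        u+1 = trans (cong (_+_ u) (sym (*-inv 1+w≢0))) (solve 2 (λ u w → u :+ (:1 :+ w) :* u := w :* u) refl u w)

        -- Once the products w y are replaced by 1, the factor w³ + w² + w + 1 = (1 + w)³ is
        -- cancelled by u³.
        d-eq : d * (u * ((u + 1#) * (u + 1#))) ≡ a * a
        d-eq = begin
          d * (u * ((u + 1#) * (u + 1#)))
            ≡⟨ cong (λ s → d * (u * (s * s))) u+1 ⟩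
          d * (u * (w * u * (w * u)))
            ≡⟨ solve 4 (λ a w u y → (a :* a :* w :+ a :* a :+ a :* a :* y :+ (a :* y) :* (a :* y)) :* (u :* (w :* u :* (w :* u)))
                 := a :* a :* (u :* u :* u) :* (w :* w :* w :+ w :* w :+ w :* (w :* y) :+ (w :* y) :* (w :* y))) refl a w u y ⟩
          a * a * (u * u * u) * (w * w * w + w * w + w * (w * y) + (w * y) * (w * y))
            ≡⟨ cong (λ t → a * a * (u * u * u) * (w * w * w + w * w + w * t + t * t)) (*-inv w≢0) ⟩
          a * a * (u * u * u) * (w * w * w + w * w + w * 1# + 1# * 1#)
            ≡⟨ solve 3 (λ a w u → a :* a :* (u :* u :* u) :* (w :* w :* w :+ w :* w :+ w :* :1 :+ :1 :* :1)
                 := a :* a :* (((:1 :+ w) :* u) :* ((:1 :+ w) :* u) :* ((:1 :+ w) :* u))) refl a w u ⟩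
          a * a * (((1# + w) * u) * ((1# + w) * u) * ((1# + w) * u))
            ≡⟨ cong (λ t → a * a * (t * t * t)) (*-inv 1+w≢0) ⟩
          a * a * (1# * 1# * 1#)
            ≡⟨ solve 1 (λ a → a :* a :* (:1 :* :1 :* :1) := a :* a) refl a ⟩
          a * a
            ∎

        arg-eq : a * a * w + (a * a * y + a * y) ≡ c * x + inv x
        arg-eq = cong₂ _+_ (sym (*-assoc (a * a) e x)) (begin
          a * a * y + a * y      ≡⟨ solve 2 (λ a y → a :* a :* y :+ a :* y := (a :* a :+ a) :* y) refl a y ⟩
          e * inv (e * x)        ≡⟨ cong (e *_) (inv-* e x) ⟩
          e * (inv e * inv x)    ≡⟨ *-inv-cancel (inv x) e≢0 ⟩
          inv x                  ∎)

        -- (a y)² has the trace of a y, which joins a² y to give e y = 1/x; the summand a² has the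
        -- trace of a and yields `sgn a`.
        sgn-d : sgn d ≡ sgn a ℤ.* kloosterman c x
        sgn-d = begin
          sgn d
            ≡⟨ sgn-+ (a * a * w + a * a + a * a * y) ((a * y) * (a * y)) ⟩
          sgn (a * a * w + a * a + a * a * y) ℤ.* sgn ((a * y) * (a * y))
            ≡⟨ cong (ℤ._*_ (sgn (a * a * w + a * a + a * a * y))) (sgn-square (a * y)) ⟩
          sgn (a * a * w + a * a + a * a * y) ℤ.* sgn (a * y)
            ≡⟨ sgn-+ (a * a * w + a * a + a * a * y) (a * y) ⟨
          sgn (a * a * w + a * a + a * a * y + a * y)
            ≡⟨ cong sgn (solve 3 (λ a w y → a :* a :* w :+ a :* a :+ a :* a :* y :+ a :* y
                 := a :* a :+ (a :* a :* w :+ (a :* a :* y :+ a :* y))) refl a w y) ⟩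
          sgn (a * a + (a * a * w + (a * a * y + a * y)))
            ≡⟨ cong (λ t → sgn (a * a + t)) arg-eq ⟩
          sgn (a * a + (c * x + inv x))
            ≡⟨ sgn-+ (a * a) (c * x + inv x) ⟩
          sgn (a * a) ℤ.* sgn (c * x + inv x)
            ≡⟨ cong₂ ℤ._*_ (sgn-square a) (sym (kloosterman-≢0 c x≢0)) ⟩
          sgn a ℤ.* kloosterman c x
            ∎

    ∑∑curve : ∑ (λ p → ∑ (curve p)) ≡ + (2 ^ m) ℤ.+ (sgn a ℤ.* K c ℤ.+ ℤ.- + 2)
    ∑∑curve = begin
      ∑ (λ p → ∑ (curve p))
        ≡⟨ ∑-reindex (λ p → ∑ (curve p)) φ ψ φψ ψφ ⟩
      ∑ (λ x → ∑ (curve (φ x)))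
        ≡⟨ ∑-cong ∑-curve-φ ⟩
      ∑ (λ x → + 1 ℤ.+ (sgn a ℤ.* kloosterman c x ℤ.+ ℤ.- + 2 ℤ.* indicator (x ≟ inv e)))
        ≡⟨ ∑-distrib (λ _ → + 1) (λ x → sgn a ℤ.* kloosterman c x ℤ.+ ℤ.- + 2 ℤ.* indicator (x ≟ inv e)) ⟩
      ∑ (λ _ → + 1) ℤ.+ ∑ (λ x → sgn a ℤ.* kloosterman c x ℤ.+ ℤ.- + 2 ℤ.* indicator (x ≟ inv e))
        ≡⟨ cong₂ ℤ._+_ ∑-1 (∑-distrib (λ x → sgn a ℤ.* kloosterman c x) (λ x → ℤ.- + 2 ℤ.* indicator (x ≟ inv e))) ⟩
      + (2 ^ m) ℤ.+ (∑ (λ x → sgn a ℤ.* kloosterman c x) ℤ.+ ∑ (λ x → ℤ.- + 2 ℤ.* indicator (x ≟ inv e)))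
        ≡⟨ cong₂ (λ u v → + (2 ^ m) ℤ.+ (u ℤ.+ v))
             (trans (∑-*ˡ (sgn a) (kloosterman c)) (cong (ℤ._*_ (sgn a)) (sym (K≡∑ c))))
             (trans (∑-*ˡ (ℤ.- + 2) (λ x → indicator (x ≟ inv e))) (cong (ℤ._*_ (ℤ.- + 2)) (∑-indicator (inv e)))) ⟩
      + (2 ^ m) ℤ.+ (sgn a ℤ.* K c ℤ.+ ℤ.- + 2)
        ∎
      where
      ψ : Carrier → Carrier
      ψ p = inv e * (1# + inv p)

      1+1+ : ∀ x → 1# + (1# + x) ≡ x
      1+1+ = solve 1 (λ x → :1 :+ (:1 :+ x) := x) refl

      φψ : ∀ p → φ (ψ p) ≡ p
      φψ p = trans (cong (λ u → inv (1# + u)) (*-inv-cancel (1# + inv p) e≢0))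
        (trans (cong inv (1+1+ (inv p))) (inv-involutive p))

      ψφ : ∀ x → ψ (φ x) ≡ x
      ψφ x = trans (cong (λ u → inv e * (1# + u)) (inv-involutive (1# + e * x)))
        (trans (cong (inv e *_) (1+1+ (e * x))) (inv-*-cancel x e≢0))

  -- The trace of 1 and the parity of m

  trace-1-even : ∀ k → trace (k ℕ.* 2) 1# ≡ 0#
  trace-1-even zero    = refl
  trace-1-even (suc k) = begin
    trace (suc (suc (k ℕ.* 2))) 1#            ≡⟨ trace-1-suc (suc (k ℕ.* 2)) ⟩
    1# + trace (suc (k ℕ.* 2)) 1#             ≡⟨ cong (_+_ 1#) (trace-1-suc (k ℕ.* 2)) ⟩
    1# + (1# + trace (k ℕ.* 2) 1#)            ≡⟨ cong (λ u → 1# + (1# + u)) (trace-1-even k) ⟩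
    1# + (1# + 0#)                            ≡⟨ solve 0 (:1 :+ (:1 :+ :0) := :0) refl ⟩
    0#                                        ∎
    where
    trace-1-suc : ∀ n → trace (suc n) 1# ≡ 1# + trace n 1#
    trace-1-suc n = trans (trace-suc n 1#) (cong (_+ trace n 1#) (frobenius-1 n))

  sgn-1-even : ∀ k → m ≡ k ℕ.* 2 → sgn 1# ≡ + 1
  sgn-1-even k m≡2k = sgn-Tr≡0 1# (trans (cong (λ n → trace n 1#) m≡2k) (trace-1-even k))

  sgn-1-odd : ∀ k → m ≡ suc (k ℕ.* 2) → sgn 1# ≡ ℤ.-1ℤ
  sgn-1-odd k m≡1+2k = sgn-Tr≢0 1# λ Tr≡0 → 0≢1 (begin
    0#                                       ≡⟨ Tr≡0 ⟨
    Tr 1#                                    ≡⟨ cong (λ n → trace n 1#) m≡1+2k ⟩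
    trace (suc (k ℕ.* 2)) 1#                 ≡⟨ trace-suc (k ℕ.* 2) 1# ⟩
    frobenius (k ℕ.* 2) 1# + trace (k ℕ.* 2) 1# ≡⟨ cong₂ _+_ (frobenius-1 (k ℕ.* 2)) (trace-1-even k) ⟩
    1# + 0#                                  ≡⟨ +-identityʳ 1# ⟩
    1#                                       ∎)

  sgn-b²+b+1 : ∀ b → sgn (b * b + b + 1#) ≡ sgn 1#
  sgn-b²+b+1 b = begin
    sgn (b * b + b + 1#)                       ≡⟨ sgn-+ (b * b + b) 1# ⟩
    sgn (b * b + b) ℤ.* sgn 1#                 ≡⟨ cong (ℤ._* sgn 1#) (sgn-+ (b * b) b) ⟩
    sgn (b * b) ℤ.* sgn b ℤ.* sgn 1#           ≡⟨ cong (λ u → u ℤ.* sgn b ℤ.* sgn 1#) (sgn-square b) ⟩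
    sgn b ℤ.* sgn b ℤ.* sgn 1#                 ≡⟨ cong (ℤ._* sgn 1#) (sgn-self b) ⟩
    + 1 ℤ.* sgn 1#                             ≡⟨ ℤ.*-identityˡ (sgn 1#) ⟩
    sgn 1#                                     ∎

  m≢1 : ∀ b → b * b + b + 1# ≢ 1# → m ≢ 1
  m≢1 b a≢1 m≡1 = a≢1 (begin
    b * b + b + 1#      ≡⟨ cong (λ u → u + b + 1#) (trans (sym (cong (λ n → frobenius n b) m≡1)) (frobenius-m b)) ⟩
    b + b + 1#          ≡⟨ cong (_+ 1#) (+-self b) ⟩
    0# + 1#             ≡⟨ +-identityˡ 1# ⟩
    1#                  ∎)

  pow-4+pow-3 : ∀ a → pow a 4 + pow a 3 ≡ a * a * (a * a + a)
  pow-4+pow-3 = solve 1 (λ a → a :* (a :* (a :* (a :* :1))) :+ a :* (a :* (a :* :1)) := a :* a :* (a :* a :+ a)) refl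

-- Combining the congruences modulo 3 and 4

3∣i⇒4∣i⇒12∣i : ∀ {i} → + 3 S.∣ i → + 4 S.∣ i → + 12 ∣ i
-- The quotient `u - v` comes from the Bézout relation 4 - 3 = 1.
3∣i⇒4∣i⇒12∣i {i} (S.divides u i≡3u) (S.divides v i≡4v) = S.∣⇒∣ᵤ (S.divides (u - v) (begin
  i                                            ≡⟨ 4i-3i i ⟩
  + 4 ℤ.* i - + 3 ℤ.* i                        ≡⟨ cong₂ (λ s t → + 4 ℤ.* s - + 3 ℤ.* t) i≡3u i≡4v ⟩
  + 4 ℤ.* (u ℤ.* + 3) - + 3 ℤ.* (v ℤ.* + 4)    ≡⟨ factor u v ⟩
  (u - v) ℤ.* + 12                             ∎))
  where
  open ≡-Reasoning
  4i-3i : ∀ i → i ≡ + 4 ℤ.* i - + 3 ℤ.* i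
  4i-3i = ℤ-Solver.solve-∀
  factor : ∀ u v → + 4 ℤ.* (u ℤ.* + 3) - + 3 ℤ.* (v ℤ.* + 4) ≡ (u - v) ℤ.* + 12
  factor = ℤ-Solver.solve-∀

4^k≡1[3] : ∀ k → ∃ λ q → + (2 ^ (k ℕ.* 2)) ≡ + 1 ℤ.+ q ℤ.* + 3
4^k≡1[3] zero    = + 0 , refl
4^k≡1[3] (suc k) with 4^k≡1[3] k
... | q , eq = + 1 ℤ.+ + 4 ℤ.* q , (begin
  + (2 ℕ.* (2 ℕ.* 2 ^ (k ℕ.* 2)))         ≡⟨ cong +_ (ℕ.*-assoc 2 2 (2 ^ (k ℕ.* 2))) ⟨
  + (4 ℕ.* 2 ^ (k ℕ.* 2))                 ≡⟨ ℤ.pos-* 4 (2 ^ (k ℕ.* 2)) ⟩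
  + 4 ℤ.* + (2 ^ (k ℕ.* 2))               ≡⟨ cong (ℤ._*_ (+ 4)) eq ⟩
  + 4 ℤ.* (+ 1 ℤ.+ q ℤ.* + 3)             ≡⟨ step q ⟩
  + 1 ℤ.+ (+ 1 ℤ.+ + 4 ℤ.* q) ℤ.* + 3     ∎)
  where
  open ≡-Reasoning
  step : ∀ q → + 4 ℤ.* (+ 1 ℤ.+ q ℤ.* + 3) ≡ + 1 ℤ.+ (+ 1 ℤ.+ + 4 ℤ.* q) ℤ.* + 3
  step = ℤ-Solver.solve-∀

4∣2^ : ∀ {m} → 1 ≤ m → m ≢ 1 → + 4 S.∣ + (2 ^ m)
4∣2^ {suc zero}    _ m≢1 = contradiction refl m≢1
4∣2^ {suc (suc k)} _ _   = S.divides (+ (2 ^ k)) (begin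
  + (2 ℕ.* (2 ℕ.* 2 ^ k))    ≡⟨ cong +_ (ℕ.*-assoc 2 2 (2 ^ k)) ⟨
  + (4 ℕ.* 2 ^ k)            ≡⟨ cong +_ (ℕ.*-comm 4 (2 ^ k)) ⟩
  + (2 ^ k ℕ.* 4)            ≡⟨ ℤ.pos-* (2 ^ k) 4 ⟩
  + (2 ^ k) ℤ.* + 4          ∎)
  where open ≡-Reasoning

theorem3 : (m : ℕ) → 1 ≤ m → (F : FiniteField m) → (b : FiniteField.Carrier F) →
    let open FiniteField F
        a = b * b + b + 1#
    in a ≢ 0# → a ≢ 1# →
       (m % 2 ≡ 1 → (+ 12) ∣ (K (pow a 4 + pow a 3) - + 3)) ×
       (m % 2 ≡ 0 → (+ 12) ∣ (K (pow a 4 + pow a 3) - + 7))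
theorem3 m 1≤m F b a≢0 a≢1 = odd , even
  where
  open FiniteField F
  open FieldProperties F 1≤m
  a = b * b + b + 1#
  open Curve a a≢0 a≢1

  N k : ℤ
  N = + (2 ^ m)
  k = K (pow a 4 + pow a 3)

  k≡K : k ≡ K c
  k≡K = cong K (pow-4+pow-3 a)

  3∣curve : + 3 S.∣ N ℤ.+ (sgn 1# ℤ.* k ℤ.+ ℤ.- + 2)
  3∣curve = subst (+ 3 S.∣_)
    (trans ∑∑curve (cong₂ (λ s t → N ℤ.+ (s ℤ.* t ℤ.+ ℤ.- + 2)) (sgn-b²+b+1 b) (sym k≡K))) 3∣∑∑curve

  4∣k+1 : + 4 S.∣ k ℤ.+ + 1
  4∣k+1 = subst (+ 4 S.∣_) (simplify k N) (S.∣m∣n⇒∣m+n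
    (subst (λ t → + 4 S.∣ t ℤ.+ + 1 - N) (sym k≡K) (4∣K+1-2^m c (*-≢0 (*-≢0 a≢0 a≢0) e≢0)))
    (4∣2^ 1≤m (m≢1 b a≢1)))
    where
    simplify : ∀ k n → k ℤ.+ + 1 - n ℤ.+ n ≡ k ℤ.+ + 1
    simplify = ℤ-Solver.solve-∀

  odd : m % 2 ≡ 1 → + 12 ∣ k - + 3
  odd m%2≡1 with 4^k≡1[3] (m / 2)
  ... | q , 4^≡ = 3∣i⇒4∣i⇒12∣i
    -- The point count is 2(1 + 3q) - k - 2 = 6q - k; subtracting it from 3(2q - 1) leaves k - 3.
    (subst (+ 3 S.∣_) (mod3 q k) (S.∣m∣n⇒∣m-n (S.divides (+ 2 ℤ.* q - + 1) refl)
      (subst (+ 3 S.∣_) (cong₂ (λ n s → n ℤ.+ (s ℤ.* k ℤ.+ ℤ.- + 2)) N≡ (sgn-1-odd (m / 2) m≡)) 3∣curve)))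
    (subst (+ 4 S.∣_) (mod4 k) (S.∣m∣n⇒∣m-n 4∣k+1 (S.divides (+ 1) refl)))
    where
    m≡ : m ≡ suc (m / 2 ℕ.* 2)
    m≡ = trans (m≡m%n+[m/n]*n m 2) (cong (ℕ._+ m / 2 ℕ.* 2) m%2≡1)

    N≡ : N ≡ + 2 ℤ.* (+ 1 ℤ.+ q ℤ.* + 3)
    N≡ = trans (cong (λ n → + (2 ^ n)) m≡) (trans (ℤ.pos-* 2 (2 ^ (m / 2 ℕ.* 2))) (cong (ℤ._*_ (+ 2)) 4^≡))

    mod3 : ∀ q k → (+ 2 ℤ.* q - + 1) ℤ.* + 3 - (+ 2 ℤ.* (+ 1 ℤ.+ q ℤ.* + 3) ℤ.+ (ℤ.-1ℤ ℤ.* k ℤ.+ ℤ.- + 2)) ≡ k - + 3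
    mod3 = ℤ-Solver.solve-∀

    mod4 : ∀ k → k ℤ.+ + 1 - + 4 ≡ k - + 3
    mod4 = ℤ-Solver.solve-∀

  even : m % 2 ≡ 0 → + 12 ∣ k - + 7
  even m%2≡0 with 4^k≡1[3] (m / 2)
  ... | q , 4^≡ = 3∣i⇒4∣i⇒12∣i
    -- The point count is (1 + 3q) + k - 2; subtracting 3(q + 2) leaves k - 7.
    (subst (+ 3 S.∣_) (mod3 q k) (S.∣m∣n⇒∣m-n
      (subst (+ 3 S.∣_) (cong₂ (λ n s → n ℤ.+ (s ℤ.* k ℤ.+ ℤ.- + 2)) N≡ (sgn-1-even (m / 2) m≡)) 3∣curve)
      (S.divides (q ℤ.+ + 2) refl)))
    (subst (+ 4 S.∣_) (mod4 k) (S.∣m∣n⇒∣m-n 4∣k+1 (S.divides (+ 2) refl)))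
    where
    m≡ : m ≡ m / 2 ℕ.* 2
    m≡ = trans (m≡m%n+[m/n]*n m 2) (cong (ℕ._+ m / 2 ℕ.* 2) m%2≡0)

    N≡ : N ≡ + 1 ℤ.+ q ℤ.* + 3
    N≡ = trans (cong (λ n → + (2 ^ n)) m≡) 4^≡

    mod3 : ∀ q k → (+ 1 ℤ.+ q ℤ.* + 3) ℤ.+ (+ 1 ℤ.* k ℤ.+ ℤ.- + 2) - (q ℤ.+ + 2) ℤ.* + 3 ≡ k - + 7
    mod3 = ℤ-Solver.solve-∀

    mod4 : ∀ k → k ℤ.+ + 1 - + 8 ≡ k - + 7
    mod4 = ℤ-Solver.solve-∀
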